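{- Let $G$ be a finite graph (loops and multiple edges allowed) and let $C$ be a circuit in $G$. If $G/C$ admits a nowhere-zero $4$-flow, then $G$ admits a $4$-flow $f$ such that $E(G) - E(C) \subseteq \mathrm{supp}(f)$ and $$\bigl|\{e \in E(C) : f(e) = 0\}\bigr| < \frac{1}{4}|E(C)|.$$
   Context: Graphs are finite and may have loops and multiple edges. A circuit is a connected $2$-regular graph. Contracting an edge means deleting the edge and then identifying its ends; $G/C$ is the graph obtained from $G$ by contracting all edges of $C$ (so edges of $G$ not in $C$ with both ends on $C$ become loops). For an abelian group $\Gamma$, a $\Gamma$-flow in $G$ is a pair $(D,f)$ where $D$ is an orientation of $E(G)$ and $f: E(G)\to\Gamma$ is such that, at every vertex $v$, the sum of $f$ over edges with tail $v$ equals the sum of $f$ over edges with head $v$. For a positive integer $k$, a $k$-flow is a $\mathbb{Z}$-flow with $|f(e)| < k$ for every edge $e$. The support is $\mathrm{supp}(f) = \{e \in E(G): f(e)\neq 0\}$, and a flow is nowhere-zero if its support is the whole edge set. -}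

module Defs where

open import Algebra.Bundles using (AbelianGroup)
open import Algebra.Properties.CommutativeMonoid.Sum using (sum)
open import Data.Bool.Base using (Bool; true; false; not; if_then_else_)
open import Data.Fin.Base using (Fin)
open import Data.Fin.Properties using (_≟_)
open import Data.Fin.Subset
open import Data.Fin.Subset.Properties
  using (_∈?_; x∈⁅x⁆; x∈p∪q⁺; x∈p∧x≢y⇒x∈p-y; p─q⊆p)
open import Data.Integer.Base as ℤ using (ℤ)
import Data.Integer.Properties as ℤ
open import Data.List.Base using (List; allFin; filter; foldr)
open import Data.Nat.Base using (ℕ; _+_; _<_)
open import Data.Product.Base using (_×_; ∃-syntax)
open import Data.Sum.Base using (inj₁; inj₂)
open import Data.Vec.Base using (tabulate)
open import Function.Base using (_∘_)
open import Level using (Level; 0ℓ; _⊔_)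
open import Relation.Binary.Construct.Closure.ReflexiveTransitive using (Star)
open import Relation.Binary.PropositionalEquality.Core using (_≡_)
open import Relation.Nullary using (¬_; yes; no; does; _×-dec_)
open import Relation.Unary using (Pred; Decidable)

private
  variable
    c ℓ p : Level
    n m : ℕ

-- { i | P i }
comprehension : {P : Pred (Fin n) p} → Decidable P → Subset n
comprehension P? = tabulate (does ∘ P?)

-- Vertices and edges are subsets of fixed finite sets of labels, so that
-- subgraphs and contractions of a graph keep its labels.  The two ends of an
-- edge e are end e true and end e false; the order in which they are listed
-- has no meaning.  The value of end on a label that is not an edge is
-- irrelevant.
record Graph (n m : ℕ) : Set where
  field
    V     : Subset n
    E     : Subset m
    end   : Fin m → Bool → Fin n
    end∈V : ∀ {e} → e ∈ E → ∀ b → end e b ∈ V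

open Graph public

infix 4 _⊑_

record _⊑_ (H G : Graph n m) : Set where
  field
    V⊆   : V H ⊆ V G
    E⊆   : E H ⊆ E G
    end≡ : ∀ {e} → e ∈ E H → ∀ b → end H e b ≡ end G e b

-- A loop at v contributes 2.
degree : Graph n m → Fin n → ℕ
degree G v = ends true + ends false
  where
  ends : Bool → ℕ
  ends b = ∣ comprehension (λ e → (e ∈? E G) ×-dec (end G e b ≟ v)) ∣

Adjacent : Graph n m → Fin n → Fin n → Set
Adjacent G u v = ∃[ e ] ∃[ b ] e ∈ E G × end G e b ≡ u × end G e (not b) ≡ v

-- The graph without vertices is not connected.
Connected : Graph n m → Set
Connected G =
  Nonempty (V G) × (∀ {u v} → u ∈ V G → v ∈ V G → Star (Adjacent G) u v)

Regular : ℕ → Graph n m → Set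
Regular d G = ∀ {v} → v ∈ V G → degree G v ≡ d

IsCircuit : Graph n m → Set
IsCircuit G = Connected G × Regular 2 G

deleteEdge : Graph n m → Fin m → Graph n m
deleteEdge G e = record
  { V     = V G
  ; E     = E G - e
  ; end   = end G
  ; end∈V = end∈V G ∘ p─q⊆p (E G) ⁅ e ⁆
  }

-- The vertex resulting from the identification of x and y is called x.  For x
-- a vertex of G, the new vertex set is V G when x is y, and V G - y otherwise.
identify : Graph n m → Fin n → Fin n → Graph n m
identify {n} G x y = record
  { V     = V′
  ; E     = E G
  ; end   = λ e b → merge (end G e b)
  ; end∈V = λ e∈E b → merge∈V′ (end∈V G e∈E b)
  }
  where
  V′ : Subset n
  V′ = (V G - y) ∪ ⁅ x ⁆

  merge : Fin n → Fin n
  merge w = if does (w ≟ y) then x else w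

  merge∈V′ : ∀ {w} → w ∈ V G → merge w ∈ V′
  merge∈V′ {w} w∈V with w ≟ y
  ... | yes _  = x∈p∪q⁺ (inj₂ (x∈⁅x⁆ x))
  ... | no w≢y = x∈p∪q⁺ (inj₁ (x∈p∧x≢y⇒x∈p-y w∈V w≢y))

-- Meaningful when e is an edge of G.
contractEdge : Graph n m → Fin m → Graph n m
contractEdge G e = identify (deleteEdge G e) (end G e true) (end G e false)

elements : Subset n → List (Fin n)
elements {n} S = filter (_∈? S) (allFin n)

infixl 7 _/_

-- Meaningful when C is a subgraph of G.  The edges of C are contracted one
-- after the other; one that has become a loop in the process is just deleted.
_/_ : Graph n m → Graph n m → Graph n m
G / C = foldr (λ e H → contractEdge H e) G (elements (E C))

-- e is directed from end e (D e) to end e (not (D e)).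
Orientation : ℕ → Set
Orientation m = Fin m → Bool

tail head : Graph n m → Orientation m → Fin m → Fin n
tail G D e = end G e (D e)
head G D e = end G e (not (D e))

module _ (Γ : AbelianGroup c ℓ) where
  open AbelianGroup Γ

  sumOver : Subset m → (Fin m → Carrier) → Carrier
  sumOver S f = sum commutativeMonoid (λ e → if does (e ∈? S) then f e else ε)

  -- The values of D and f on labels that are not edges are irrelevant.
  record Flow (G : Graph n m) : Set (c ⊔ ℓ) where
    field
      D : Orientation m
      f : Fin m → Carrier
      conservation : ∀ {v} → v ∈ V G →
        sumOver (comprehension (λ e → (e ∈? E G) ×-dec (tail G D e ≟ v))) f ≈
        sumOver (comprehension (λ e → (e ∈? E G) ×-dec (head G D e ≟ v))) f

    supp : Pred (Fin m) ℓ
    supp e = e ∈ E G × ¬ (f e ≈ ε)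

    NowhereZero : Set ℓ
    NowhereZero = ∀ {e} → e ∈ E G → supp e

record KFlow (k : ℕ) (G : Graph n m) : Set where
  field
    flow : Flow ℤ.+-0-abelianGroup G

  open Flow flow public

  field
    bounded : ∀ {e} → e ∈ E G → ℤ.∣ f e ∣ < k

  zeros : Subset m
  zeros = comprehension (λ e → (e ∈? E G) ×-dec (f e ℤ.≟ ℤ.0ℤ))

{-# OPTIONS --safe #-}

-- A nowhere-zero 4-flow of G / C lifts to an integer flow of G, and reducing
-- it modulo 4 gives a ℤ₂ × ℤ₂-flow (g₁ , g₂) of G that vanishes nowhere outside
-- C; conversely such a pair is a 4-flow with the same zeros.  Adding elements
-- of ℤ₂ × ℤ₂ along C permutes the four value classes on C, so one of them can be
-- made the class of zeros, and it is small enough unless all four have size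
-- |E(C)| / 4.  In that case g₁ is balanced on C: the signs (-1)^g₁ along C add
-- up to 0, so they are the increments of a potential F on the vertices of C.  At a
-- maximum p of F the value of g₁ changes.  Up to replacing g₂ by g₁ + g₂, so does
-- that of g₂; hence p has odd degree in supp g₂ - E(C), which contains a path
-- from p to another odd vertex q, on C.  Add to g₁ this path and an arc of C from
-- q to p.  If g₁ is still balanced, then F q = F p, so that q was a maximum as
-- well, and g₁ now changes at neither p nor q: the number of changes of g₁ along
-- C has decreased.
module Submission where

open import Defs
open import Data.Fin.Subset using (_∈_; _∩_; _─_; ∣_∣)
open import Data.Nat.Base using (ℕ; _*_; _<_)
open import Data.Product.Base using (_×_; Σ-syntax)

open import Algebra.Bundles using (CommutativeRing)
open import Algebra.Structures using (IsCommutativeRing)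
open import Data.Bool.Base
  using (Bool; true; false; not; _∧_; _∨_; _xor_; if_then_else_)
open import Data.Bool.Properties as Bool
  using (xor-∧-commutativeRing; xor-comm; xor-same; xor-identityʳ; not-involutive; ∧-distribˡ-xor)
open import Data.Fin.Base using (Fin; zero; suc)
open import Data.Fin.Properties using (_≟_)
open import Data.Fin.Subset using (Subset; _⊂_; _⊆_)
open import Data.Fin.Subset.Induction using (⊂-wellFounded)
open import Data.Fin.Subset.Properties
  using (_∈?_; p⊆q⇒∣p∣≤∣q∣; p─q⊆p; x∈p∧x≢y⇒x∈p-y; x∈p∩q⁻)
open import Data.Integer.Base as ℤ using (ℤ; 0ℤ; 1ℤ; -1ℤ)
import Data.Integer.Properties as ℤ
open import Data.Integer.Tactic.RingSolver using (solve-∀)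
open import Data.List.Base using (List; []; _∷_; allFin; filter; foldr)
open import Data.List.Extrema ℤ.≤-totalOrder using (argmax; argmax-all; f[xs]≤f[argmax])
import Data.List.Membership.Propositional as List
open import Data.List.Membership.Propositional.Properties using (∈-allFin; ∈-filter⁺; ∈-filter⁻)
open import Data.List.Relation.Unary.All using (lookup)
open import Data.List.Relation.Unary.All.Properties using (all-filter)
open import Data.List.Relation.Unary.Any using (here; there)
open import Data.Nat.Base as ℕ using (zero; suc)
import Data.Nat.Properties as ℕ
open import Data.Product.Base using (_,_; ∃-syntax; proj₁; proj₂)
open import Data.Sum.Base using (_⊎_; inj₁; inj₂)
open import Data.Vec.Base using (tabulate; _∷_; there)
open import Data.Vec.Functional using (updateAt)
open import Data.Vec.Functional.Properties using (updateAt-updates; updateAt-minimal)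
open import Data.Vec.Properties using (lookup∘tabulate; []=⇒lookup; lookup⇒[]=)
open import Function.Base using (_∘_; const)
open import Induction.WellFounded using (Acc; acc)
open import Relation.Binary.Construct.Closure.ReflexiveTransitive using (Star; ε; _◅_)
open import Relation.Binary.PropositionalEquality
open import Relation.Nullary using (¬_; Dec; yes; no; does; contradiction; _×-dec_)
open import Relation.Nullary.Decidable using (dec-true; dec-false)

-- Averaging over the four shifts only bounds the smallest value class by a quarter of the circuit;
-- the rest of the argument is there to make this strict. One unbalanced coordinate is enough: the
-- rarer of the two values of `g₁` fills less than half of C, so one of the two classes into which
-- `g₂` splits it fills less than a quarter. The lift from G / C can take any integer values on C;
-- only residues count there, while outside C the absolute values 1, 2, 3 stay nonzero modulo 4.
-- Addition modulo 4 has carries, so the second digit is not a flow by itself; it becomes one once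
-- an orientation of the odd part has been subtracted. The path from p to q may be added to `g₁`
-- because `g₂` is nonzero on it, which keeps the union of the two supports outside C. Switching
-- `g₁` on the arc reverses the signs there and so changes their total by minus twice their sum
-- along the arc, which is the difference of F between p and q up to sign; balance before and after
-- therefore forces F q = F p.

private
  variable
    k m n : ℕ

-- The boundary of a chain x on the edges s e → t e is used in dual form, as
-- the functional P ↦ ∑ₑ x e (P (t e) - P (s e)) on vertex functions P.
module Chains {A : Set} {_⊕_ _⊗_ : A → A → A} {⊖_ : A → A} {0ᴬ 1ᴬ : A}
  (isCommutativeRing : IsCommutativeRing _≡_ _⊕_ _⊗_ ⊖_ 0ᴬ 1ᴬ) where

  private
    R : CommutativeRing _ _
    R = record { isCommutativeRing = isCommutativeRing }

  open CommutativeRing R using (_+_; -_; _-_; 0#; 1#) renaming (_*_ to _·_)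
  open CommutativeRing R public
    using (+-comm; +-assoc; +-identityˡ; +-identityʳ; -‿inverseʳ;
           *-assoc; *-identityˡ; *-identityʳ; zeroˡ; zeroʳ; distribˡ; distribʳ)
  open import Algebra.Properties.Ring (CommutativeRing.ring R) public
    using (-‿distribʳ-*; -‿+-comm)
  open import Algebra.Properties.Semiring.Sum (CommutativeRing.semiring R) public
    using (sum; ∑-comm; ∑-distrib-+; *-distribˡ-sum; sum-cong-≗; sum-replicate-zero)
  open import Algebra.Properties.CommutativeSemigroup
    (CommutativeRing.+-commutativeSemigroup R) public using (interchange; xy∙z≈xz∙y)
  open import Algebra.Properties.CommutativeSemigroup
    (CommutativeRing.*-commutativeSemigroup R) using (x∙yz≈y∙xz)

  sum-zero : {f : Fin k → A} → (∀ i → f i ≡ 0#) → sum f ≡ 0#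
  sum-zero {k} f≡0 = trans (sum-cong-≗ f≡0) (sum-replicate-zero k)

  sum-single : {f : Fin k → A} (j : Fin k) → (∀ i → i ≢ j → f i ≡ 0#) → sum f ≡ f j
  sum-single {f = f} zero f≡0 =
    trans (cong (f zero +_) (sum-zero λ i → f≡0 (suc i) λ ())) (+-identityʳ _)
  sum-single {f = f} (suc j) f≡0 = trans
    (cong₂ _+_ (f≡0 zero λ ()) (sum-single j λ i i≢j → f≡0 (suc i) λ { refl → i≢j refl }))
    (+-identityˡ _)

  sum-change : {f g : Fin k → A} {c : A} (j : Fin k) →
    (∀ i → i ≢ j → f i ≡ g i) → f j ≡ g j + c → sum f ≡ sum g + c
  sum-change {g = g} zero f≡g fj≡ = trans
    (cong₂ _+_ fj≡ (sum-cong-≗ λ i → f≡g (suc i) λ ())) (xy∙z≈xz∙y (g zero) _ _)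
  sum-change {g = g} (suc j) f≡g fj≡ = trans
    (cong₂ _+_ (f≡g zero λ ()) (sum-change j (λ i i≢j → f≡g (suc i) λ { refl → i≢j refl }) fj≡))
    (sym (+-assoc (g zero) _ _))

  -- The test is `j ≟ i` in this order so that `δ v (t e)` matches the comprehensions in `degree`
  -- and `Flow`, which test an end against `v`.
  δ : Fin k → Fin k → A
  δ i j = if does (j ≟ i) then 1# else 0#

  δ-diag : (i : Fin k) → δ i i ≡ 1#
  δ-diag i = cong (if_then 1# else 0#) (dec-true (i ≟ i) refl)

  δ-off : {i j : Fin k} → j ≢ i → δ i j ≡ 0#
  δ-off {i = i} {j} j≢i = cong (if_then 1# else 0#) (dec-false (j ≟ i) j≢i)

  sum-δ : (P : Fin k → A) (j : Fin k) → sum (λ i → P i · δ i j) ≡ P j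
  sum-δ P j = trans
    (sum-single j λ i i≢j → trans (cong (P i ·_) (δ-off (i≢j ∘ sym))) (zeroʳ _))
    (trans (cong (P j ·_) (δ-diag j)) (*-identityʳ _))

  *-distribˡ-- : ∀ x y z → x · (y - z) ≡ (x · y) - (x · z)
  *-distribˡ-- x y z = trans (distribˡ x y (- z)) (cong (x · y +_) (sym (-‿distribʳ-* x z)))

  sum-- : (f g : Fin k → A) → sum (λ i → f i - g i) ≡ (sum f - sum g)
  sum-- {zero} f g = sym (-‿inverseʳ 0#)
  sum-- {suc k} f g = trans (cong ((f zero - g zero) +_) (sum-- (f ∘ suc) (g ∘ suc)))
    (trans (interchange _ _ _ _) (cong ((f zero + sum (f ∘ suc)) +_) (-‿+-comm _ _)))

  module Boundary {m n : ℕ} (s t : Fin m → Fin n) where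

    ∂ : (Fin m → A) → (Fin n → A) → A
    ∂ x P = sum λ e → x e · (P (t e) - P (s e))

    IsCycle : (Fin m → A) → Set
    IsCycle x = ∀ P → ∂ x P ≡ 0#

    ∂-cong : ∀ {x y} → (∀ e → x e ≡ y e) → ∀ P → ∂ x P ≡ ∂ y P
    ∂-cong x≡y P = sum-cong-≗ λ e → cong (_· (P (t e) - P (s e))) (x≡y e)

    ∂-+ : ∀ x y P → ∂ (λ e → x e + y e) P ≡ ∂ x P + ∂ y P
    ∂-+ x y P = trans (sum-cong-≗ λ e → distribʳ _ (x e) (y e)) (∑-distrib-+ {m} _ _)

    ∂-* : ∀ c x P → ∂ (λ e → c · x e) P ≡ c · ∂ x P
    ∂-* c x P = trans (sum-cong-≗ λ e → *-assoc c (x e) _) (sym (*-distribˡ-sum {m} c _))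

    ∂-δ : ∀ e P → ∂ (δ e) P ≡ P (t e) - P (s e)
    ∂-δ e P = trans
      (sum-single e λ e′ e′≢e → trans (cong (_· (P (t e′) - P (s e′))) (δ-off e′≢e)) (zeroˡ _))
      (trans (cong (_· (P (t e) - P (s e))) (δ-diag e)) (*-identityˡ _))

    ∂-split : ∀ x P → ∂ x P ≡ sum (λ e → x e · P (t e)) - sum (λ e → x e · P (s e))
    ∂-split x P = trans (sum-cong-≗ λ e → *-distribˡ-- (x e) _ _) (sum-- {m} _ _)

    -- Every vertex function is a combination of the indicators `δ v`. This is how conservation at
    -- the single vertices becomes `IsCycle`.
    ∂-expand : ∀ x P → ∂ x P ≡ sum λ v → P v · ∂ x (δ v)
    ∂-expand x P = begin
      sum (λ e → x e · (P (t e) - P (s e)))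
        ≡⟨ sum-cong-≗ (λ e → cong (x e ·_) (difference e)) ⟩
      sum (λ e → x e · sum (λ v → P v · (δ v (t e) - δ v (s e))))
        ≡⟨ sum-cong-≗ (λ e → trans (*-distribˡ-sum {n} (x e) _)
             (sum-cong-≗ λ v → x∙yz≈y∙xz (x e) (P v) _)) ⟩
      sum (λ e → sum (λ v → P v · (x e · (δ v (t e) - δ v (s e)))))
        ≡⟨ ∑-comm {m} {n} _ ⟩
      sum (λ v → sum (λ e → P v · (x e · (δ v (t e) - δ v (s e)))))
        ≡⟨ sum-cong-≗ (λ v → *-distribˡ-sum {m} (P v) _) ⟨
      sum (λ v → P v · ∂ x (δ v)) ∎
      where
      open ≡-Reasoning
      difference : ∀ e → P (t e) - P (s e) ≡ sum (λ v → P v · (δ v (t e) - δ v (s e)))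
      difference e = begin
        P (t e) - P (s e)
          ≡⟨ cong₂ _-_ (sum-δ P (t e)) (sum-δ P (s e)) ⟨
        sum (λ v → P v · δ v (t e)) - sum (λ v → P v · δ v (s e))
          ≡⟨ sum-- {n} _ _ ⟨
        sum (λ v → (P v · δ v (t e)) - (P v · δ v (s e)))
          ≡⟨ sum-cong-≗ (λ v → *-distribˡ-- (P v) _ _) ⟨
        sum (λ v → P v · (δ v (t e) - δ v (s e))) ∎

-- Paths and orientations of ℤ₂-chains

module ℤᶜ = Chains ℤ.+-*-isCommutativeRing
module 𝔹 = Chains (CommutativeRing.isCommutativeRing xor-∧-commutativeRing)

∈-tabulate⁺ : (f : Fin k → Bool) {i : Fin k} → f i ≡ true → i ∈ tabulate f
∈-tabulate⁺ f {i} fi = lookup⇒[]= i (tabulate f) (trans (lookup∘tabulate f i) fi)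

∈-tabulate⁻ : (f : Fin k → Bool) {i : Fin k} → i ∈ tabulate f → f i ≡ true
∈-tabulate⁻ f {i} i∈f = trans (sym (lookup∘tabulate f i)) ([]=⇒lookup i∈f)

tabulate-⊂ : (f g : Fin k → Bool) → (∀ i → f i ≡ true → g i ≡ true) →
  (j : Fin k) → g j ≡ true → f j ≡ false → tabulate f ⊂ tabulate g
tabulate-⊂ f g f⊆g j gj fj =
  (λ i∈f → ∈-tabulate⁺ g (f⊆g _ (∈-tabulate⁻ f i∈f))) ,
  j , ∈-tabulate⁺ g gj , λ j∈f → contradiction (trans (sym (∈-tabulate⁻ f j∈f)) fj) λ ()

sum-true : (f : Fin k → Bool) → 𝔹.sum f ≡ true → ∃[ i ] f i ≡ true
sum-true {suc k} f Σf with f zero in eq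
... | true = zero , eq
... | false = let i , fi = sum-true (f ∘ suc) Σf in suc i , fi

xor-trans : ∀ x y z → (x xor y) xor (y xor z) ≡ x xor z
xor-trans false false z = refl
xor-trans false true z = not-involutive z
xor-trans true false z = refl
xor-trans true true z = refl

side : Bool → (Fin m → Fin n) → (Fin m → Fin n) → Fin m → Fin n
side c s t e = if c then s e else t e

side-xor : ∀ c (s t : Fin m → Fin n) e (P : Fin n → Bool) →
  P (t e) xor P (s e) ≡ P (side (not c) s t e) xor P (side c s t e)
side-xor false s t e P = xor-comm (P (t e)) _
side-xor true s t e P = refl

-- Over ℤ₂ the two ends of a loop cancel, so a true summand can only come from an edge with exactly
-- one end at `p`.
odd-end : (s t : Fin m → Fin n) (h : Fin m → Bool) (p : Fin n) →
  𝔹.Boundary.∂ s t h (𝔹.δ p) ≡ true →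
  ∃[ e ] ∃[ c ] h e ≡ true × side c s t e ≡ p × side (not c) s t e ≢ p
odd-end s t h p odd with sum-true _ odd
... | e , he with h e in eq | t e ≟ p | s e ≟ p
... | true | yes te≡p | no se≢p = e , false , eq , te≡p , se≢p
... | true | no te≢p | yes se≡p = e , true , eq , se≡p , te≢p
... | true | yes _ | yes _ = contradiction he λ ()
... | true | no _ | no _ = contradiction he λ ()

OddPath : (s t : Fin m → Fin n) (h : Fin m → Bool) (p : Fin n) → Set
OddPath {m} {n} s t h p = Σ[ q ∈ Fin n ] q ≢ p × ∂ h (𝔹.δ q) ≡ true ×
  Σ[ x ∈ (Fin m → Bool) ]
    (∀ e → x e ≡ true → h e ≡ true) × (∀ P → ∂ x P ≡ P q xor P p)
  where open 𝔹.Boundary s t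

-- Follow edges of h, deleting them: when the other end q of an edge at p is
-- not odd, it becomes odd once the edge is deleted.
oddPath : (s t : Fin m → Fin n) (h : Fin m → Bool) (p : Fin n) →
  𝔹.Boundary.∂ s t h (𝔹.δ p) ≡ true → OddPath s t h p
oddPath {m} {n} s t h₀ p₀ = go h₀ p₀ (⊂-wellFounded (tabulate h₀))
  where
  open 𝔹.Boundary s t
  go : (h : Fin m → Bool) (p : Fin n) → Acc _⊂_ (tabulate h) → ∂ h (𝔹.δ p) ≡ true → OddPath s t h p
  go h p (acc rec) odd with odd-end s t h p odd
  ... | e , c , he , refl , q≢p = cont (∂ h (𝔹.δ q)) refl
    where
    q = side (not c) s t e
    ∂δ : ∀ P → ∂ (𝔹.δ e) P ≡ P q xor P p
    ∂δ P = trans (∂-δ e P) (side-xor c s t e P)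
    δ⊆h : ∀ e′ → 𝔹.δ e e′ ≡ true → h e′ ≡ true
    δ⊆h e′ δe′ with e′ ≟ e
    ... | yes refl = he
    h′ : Fin m → Bool
    h′ e′ = h e′ xor 𝔹.δ e e′
    h′⊆h : ∀ e′ → h′ e′ ≡ true → h e′ ≡ true
    h′⊆h e′ h′e′ with e′ ≟ e
    ... | yes refl = he
    ... | no _ = trans (sym (xor-identityʳ (h e′))) h′e′
    h′e : h′ e ≡ false
    h′e = cong₂ _xor_ he (𝔹.δ-diag e)
    ∂h′ : ∀ P → ∂ h′ P ≡ ∂ h P xor (P q xor P p)
    ∂h′ P = trans (∂-+ h (𝔹.δ e) P) (cong (∂ h P xor_) (∂δ P))
    cont : ∀ b → ∂ h (𝔹.δ q) ≡ b → OddPath s t h p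
    cont true q-odd = q , q≢p , q-odd , 𝔹.δ e , δ⊆h , ∂δ
    cont false q-even
      with go h′ q (rec (tabulate-⊂ h′ h h′⊆h e he h′e))
        (trans (∂h′ (𝔹.δ q))
          (cong₂ _xor_ q-even (cong₂ _xor_ (𝔹.δ-diag q) (𝔹.δ-off (q≢p ∘ sym)))))
    ... | r , r≢q , r-odd , x , x⊆h′ , ∂x =
      r , r≢p , r-odd′ , (λ e′ → x e′ xor 𝔹.δ e e′) , x′⊆h ,
      λ P → trans (∂-+ x (𝔹.δ e) P)
        (trans (cong₂ _xor_ (∂x P) (∂δ P)) (xor-trans (P r) (P q) (P p)))
      where
      -- Deleting `e` flips the parity at `p` and `q` only. Thus `p` is even in `h′` and cannot be
      -- the end of the recursive path, and `r` is odd in `h` because it is odd in `h′`.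
      r≢p : r ≢ p
      r≢p r≡p = contradiction (trans (sym r-odd) (trans (∂h′ (𝔹.δ r))
        (trans (cong (λ v → ∂ h (𝔹.δ v) xor (𝔹.δ v q xor 𝔹.δ v p)) r≡p)
        (cong₂ _xor_ odd (cong₂ _xor_ (𝔹.δ-off q≢p) (𝔹.δ-diag p)))))) λ ()
      r-odd′ : ∂ h (𝔹.δ r) ≡ true
      r-odd′ = trans (sym (xor-identityʳ _))
        (trans (cong (∂ h (𝔹.δ r) xor_)
          (sym (cong₂ _xor_ (𝔹.δ-off (r≢q ∘ sym)) (𝔹.δ-off (r≢p ∘ sym)))))
        (trans (sym (∂h′ (𝔹.δ r))) r-odd))
      x′⊆h : ∀ e′ → x e′ xor 𝔹.δ e e′ ≡ true → h e′ ≡ true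
      x′⊆h e′ x′e′ with x e′ in xe′
      ... | true = h′⊆h e′ (x⊆h′ e′ xe′)
      ... | false = δ⊆h e′ x′e′

-- o tells whether the edge is directed from its end s to its end t.
signed : Bool → Bool → ℤ
signed o false = 0ℤ
signed true true = 1ℤ
signed false true = -1ℤ

Orients : (s t : Fin m → Fin n) (g : Fin m → Bool) → Set
Orients {m} s t g =
  Σ[ o ∈ (Fin m → Bool) ] ℤᶜ.Boundary.IsCycle s t (λ e → signed (o e) (g e))

-- Eulerian orientation, by induction on the number of labels: a loop or an edge outside `g` is
-- dropped, and any other edge is merged with a second edge of `g` at its end `t zero`, which exists
-- by parity. The merging moves ends, so `s` and `t` vary in the induction.
signed-even : ∀ {m n} (s t : Fin m → Fin n) (g : Fin m → Bool) →
  𝔹.Boundary.IsCycle s t g →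
  Orients s t g
signed-even {zero} s t g even = (λ ()) , λ P → refl
signed-even {suc m} {n} s t g even = cases (g zero) refl (s zero ≟ t zero)
  where
  ends-even : ∀ P → (g zero ∧ (P (t zero) xor P (s zero))) ≡ false →
    𝔹.Boundary.∂ (s ∘ suc) (t ∘ suc) (g ∘ suc) P ≡ false
  ends-even P z = trans (cong (_xor 𝔹.Boundary.∂ (s ∘ suc) (t ∘ suc) (g ∘ suc) P) (sym z)) (even P)
  skip : (∀ P → (g zero ∧ (P (t zero) xor P (s zero))) ≡ false) →
    (∀ P → signed true (g zero) ℤ.* (P (t zero) ℤ.- P (s zero)) ≡ 0ℤ) →
    Orients s t g
  skip z z′ = let o , cyc = signed-even (s ∘ suc) (t ∘ suc) (g ∘ suc) (λ P → ends-even P (z P)) in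
    (λ { zero → true ; (suc e) → o e }) , λ P → cong₂ ℤ._+_ (z′ P) (cyc P)
  cases : ∀ b → g zero ≡ b → Dec (s zero ≡ t zero) → Orients s t g
  cases false g₀ _ = skip (λ P → cong (_∧ (P (t zero) xor P (s zero))) g₀)
    λ P → cong (λ b → signed true b ℤ.* (P (t zero) ℤ.- P (s zero))) g₀
  cases true g₀ (yes s≡t) = skip
    (λ P → cong₂ _∧_ g₀ (trans (cong (λ v → P v xor P (s zero)) (sym s≡t)) (xor-same (P (s zero)))))
    λ P → trans (cong (λ v → signed true (g zero) ℤ.* (P (t zero) ℤ.- P v)) s≡t)
      (trans (cong (signed true (g zero) ℤ.*_) (ℤ.+-inverseʳ (P (t zero))))
        (ℤ.*-zeroʳ (signed true (g zero))))
  cases true g₀ (no s≢t) = join (odd-end (s ∘ suc) (t ∘ suc) (g ∘ suc) (t zero)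
      (trans (sym (not-involutive _)) (cong not (trans
        (cong (_xor 𝔹.Boundary.∂ (s ∘ suc) (t ∘ suc) (g ∘ suc) (𝔹.δ (t zero))) (sym first))
        (even (𝔹.δ (t zero)))))))
    where
    -- Split off: the edge zero and a further edge j at v = t zero are replaced
    -- by a single edge from s zero to the other end of j.
    first : (g zero ∧ (𝔹.δ (t zero) (t zero) xor 𝔹.δ (t zero) (s zero))) ≡ true
    first = cong₂ _∧_ g₀ (cong₂ _xor_ (𝔹.δ-diag (t zero)) (𝔹.δ-off s≢t))
    join : ∃[ j ] ∃[ c ] g (suc j) ≡ true × side c (s ∘ suc) (t ∘ suc) j ≡ t zero ×
      side (not c) (s ∘ suc) (t ∘ suc) j ≢ t zero → Orients s t g
    join (j , c , gj , near , _) = o′ , cyc′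
      where
      far = side (not c) (s ∘ suc) (t ∘ suc) j
      s′ t′ : Fin m → Fin n
      s′ = updateAt (s ∘ suc) j (const (s zero))
      t′ = updateAt (t ∘ suc) j (const far)
      even′ : 𝔹.Boundary.IsCycle s′ t′ (g ∘ suc)
      even′ P = trans
        (𝔹.sum-change j
          (λ e e≢j → cong₂ (λ v w → g (suc e) ∧ (P v xor P w))
            (updateAt-minimal e j (t ∘ suc) e≢j) (updateAt-minimal e j (s ∘ suc) e≢j))
          change)
        (trans (xor-comm (𝔹.Boundary.∂ (s ∘ suc) (t ∘ suc) (g ∘ suc) P) _)
          (trans (cong (λ b → (b ∧ (P (t zero) xor P (s zero))) xor
              𝔹.Boundary.∂ (s ∘ suc) (t ∘ suc) (g ∘ suc) P) (sym g₀))
            (even P)))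
        where
        change : g (suc j) ∧ (P (t′ j) xor P (s′ j)) ≡
          (g (suc j) ∧ (P (t (suc j)) xor P (s (suc j)))) xor (P (t zero) xor P (s zero))
        change = trans (cong₂ (λ v w → g (suc j) ∧ (P v xor P w))
            (updateAt-updates j (t ∘ suc)) (updateAt-updates j (s ∘ suc)))
          (trans (cong (_∧ (P far xor P (s zero))) gj)
          (trans (sym (xor-trans (P far) (P (t zero)) (P (s zero))))
          (cong (_xor (P (t zero) xor P (s zero)))
            (trans (cong (λ v → P far xor P v) (sym near))
            (trans (sym (side-xor c (s ∘ suc) (t ∘ suc) j P))
            (cong (_∧ (P (t (suc j)) xor P (s (suc j)))) (sym gj)))))))
      rec = signed-even s′ t′ (g ∘ suc) even′
      o = proj₁ rec
      -- The merged edge runs from `s zero` through `t zero` to `far`. The edge `zero` inherits its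
      -- direction; so does `j` if it leaves `t zero` at its `s` end, and otherwise `j` is traversed
      -- from `t` to `s` and gets the opposite one.
      o′ : Fin (suc m) → Bool
      o′ zero = o j
      o′ (suc e) = if does (e ≟ j) then (if c then o j else not (o j)) else o e
      cyc′ : ℤᶜ.Boundary.IsCycle s t (λ e → signed (o′ e) (g e))
      cyc′ P = trans (cong₂ ℤ._+_ (cong (λ b → signed (o j) b ℤ.* (P (t zero) ℤ.- P (s zero))) g₀) refl)
        (trans (ℤ.+-comm _ (ℤᶜ.Boundary.∂ (s ∘ suc) (t ∘ suc) (λ e → signed (o′ (suc e)) (g (suc e))) P))
        (trans (sym (ℤᶜ.sum-change j
          (λ e e≢j → trans (cong₂ (λ v w → signed (o e) (g (suc e)) ℤ.* (P v ℤ.- P w))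
            (updateAt-minimal e j (t ∘ suc) e≢j) (updateAt-minimal e j (s ∘ suc) e≢j))
            (cong (λ b → signed b (g (suc e)) ℤ.* (P (t (suc e)) ℤ.- P (s (suc e)))) (sym (other e e≢j))))
          change)) (proj₂ rec P)))
        where
        other : ∀ e → e ≢ j → o′ (suc e) ≡ o e
        other e e≢j with e ≟ j
        ... | yes e≡j = contradiction e≡j e≢j
        ... | no _ = refl
        at-j : o′ (suc j) ≡ (if c then o j else not (o j))
        at-j with j ≟ j
        ... | yes _ = refl
        ... | no j≢j = contradiction refl j≢j
        telescope : ∀ c b (x y f : Fin n) → (if c then x else y) ≡ t zero → (if not c then x else y) ≡ f →
          signed b true ℤ.* (P f ℤ.- P (s zero)) ≡
          signed (if c then b else not b) true ℤ.* (P y ℤ.- P x) ℤ.+ signed b true ℤ.* (P (t zero) ℤ.- P (s zero))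
        telescope true true x y f refl refl = lemma (P y) (P (s zero)) (P x)
          where lemma : ∀ p q r → 1ℤ ℤ.* (p ℤ.- q) ≡ 1ℤ ℤ.* (p ℤ.- r) ℤ.+ 1ℤ ℤ.* (r ℤ.- q)
                lemma = solve-∀
        telescope true false x y f refl refl = lemma (P y) (P (s zero)) (P x)
          where lemma : ∀ p q r → -1ℤ ℤ.* (p ℤ.- q) ≡ -1ℤ ℤ.* (p ℤ.- r) ℤ.+ -1ℤ ℤ.* (r ℤ.- q)
                lemma = solve-∀
        telescope false true x y f refl refl = lemma (P x) (P (s zero)) (P y)
          where lemma : ∀ p q r → 1ℤ ℤ.* (p ℤ.- q) ≡ -1ℤ ℤ.* (r ℤ.- p) ℤ.+ 1ℤ ℤ.* (r ℤ.- q)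
                lemma = solve-∀
        telescope false false x y f refl refl = lemma (P x) (P (s zero)) (P y)
          where lemma : ∀ p q r → -1ℤ ℤ.* (p ℤ.- q) ≡ 1ℤ ℤ.* (r ℤ.- p) ℤ.+ -1ℤ ℤ.* (r ℤ.- q)
                lemma = solve-∀
        change : signed (o j) (g (suc j)) ℤ.* (P (t′ j) ℤ.- P (s′ j)) ≡
          signed (o′ (suc j)) (g (suc j)) ℤ.* (P (t (suc j)) ℤ.- P (s (suc j))) ℤ.+
          signed (o j) true ℤ.* (P (t zero) ℤ.- P (s zero))
        change = trans (cong₂ (λ v w → signed (o j) (g (suc j)) ℤ.* (P v ℤ.- P w))
            (updateAt-updates j (t ∘ suc)) (updateAt-updates j (s ∘ suc)))
          (trans (cong (λ b → signed (o j) b ℤ.* (P far ℤ.- P (s zero))) gj)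
          (trans (telescope c (o j) _ _ far near refl)
          (cong (ℤ._+ signed (o j) true ℤ.* (P (t zero) ℤ.- P (s zero)))
            (cong₂ (λ b b′ → signed b b′ ℤ.* (P (t (suc j)) ℤ.- P (s (suc j)))) (sym at-j) (sym gj)))))

-- Chains on a circuit

record UniqueAt (c : Fin m → Bool) (f : Fin m → Fin n) (v : Fin n) : Set where
  field
    edge : Fin m
    edge∈c : c edge ≡ true
    edge-at : f edge ≡ v
    unique : ∀ {e} → c e ≡ true → f e ≡ v → e ≡ edge

-- Steps go both ways because the connectedness of a circuit is undirected.
data Step {m n} (s t : Fin m → Fin n) (c : Fin m → Bool) : Fin n → Fin n → Set where
  forth : ∀ {e} → c e ≡ true → Step s t c (s e) (t e)
  back  : ∀ {e} → c e ≡ true → Step s t c (t e) (s e)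

module ChainsOnCircuit {A : Set} {_⊕_ _⊗_ : A → A → A} {⊖_ : A → A} {0ᴬ 1ᴬ : A}
  (isCommutativeRing : IsCommutativeRing _≡_ _⊕_ _⊗_ ⊖_ 0ᴬ 1ᴬ)
  {m n : ℕ} (s t : Fin m → Fin n) (c : Fin m → Bool) where

  open Chains isCommutativeRing
  open Boundary s t
  private
    R : CommutativeRing _ _
    R = record { isCommutativeRing = isCommutativeRing }
  open CommutativeRing R using (_+_; -_; _-_; 0#; 1#) renaming (_*_ to _·_)
  open import Algebra.Properties.Ring (CommutativeRing.ring R)
    using (-1*x≈-x; -‿anti-homo-+; -‿involutive)
  open ≡-Reasoning

  SupportedOn : (Fin m → A) → Set
  SupportedOn x = ∀ {e} → c e ≡ false → x e ≡ 0#

  sum-unique : ∀ {f : Fin m → Fin n} {v x} → SupportedOn x → (u : UniqueAt c f v) →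
    sum (λ e → x e · δ v (f e)) ≡ x (UniqueAt.edge u)
  sum-unique {f} {v} {x} supp u = trans (sum-single edge vanish)
    (trans (cong (x edge ·_) (trans (cong (δ v) edge-at) (δ-diag v))) (*-identityʳ _))
    where
    open UniqueAt u
    vanish : ∀ e → e ≢ edge → x e · δ v (f e) ≡ 0#
    vanish e e≢edge with c e in ce
    ... | false = trans (cong (_· δ v (f e)) (supp ce)) (zeroˡ _)
    ... | true = trans (cong (x e ·_) (δ-off (λ fe≡v → e≢edge (unique ce fe≡v)))) (zeroʳ _)

  ∂-at : ∀ {v x} → SupportedOn x → (i : UniqueAt c t v) (o : UniqueAt c s v) →
    ∂ x (δ v) ≡ x (UniqueAt.edge i) - x (UniqueAt.edge o)
  ∂-at {v} {x} supp i o = trans (∂-split x (δ v)) (cong₂ _-_ (sum-unique supp i) (sum-unique supp o))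

  telescope : ∀ a b d → (b - a) + (d - b) ≡ d - a
  telescope a b d = begin
    (b - a) + (d - b)     ≡⟨ +-comm (b - a) (d - b) ⟩
    (d - b) + (b - a)     ≡⟨ +-assoc d (- b) (b - a) ⟩
    d + (- b + (b - a))   ≡⟨ cong (d +_) (+-assoc (- b) b (- a)) ⟨
    d + ((- b + b) - a)   ≡⟨ cong (λ z → d + (z - a)) (CommutativeRing.-‿inverseˡ R b) ⟩
    d + (0# - a)          ≡⟨ cong (d +_) (+-identityˡ (- a)) ⟩
    d - a                 ∎

  WalkChain : Fin n → Fin n → Set
  WalkChain u v = Σ[ x ∈ (Fin m → A) ] SupportedOn x × (∀ (P : Fin n → A) → ∂ x P ≡ P v - P u)

  -- Coefficients add up along the walk, and the boundaries telescope. Over ℤ the chain serves to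
  -- integrate along the circuit; over ℤ₂ repetitions cancel, and between distinct vertices of the
  -- circuit one of the two arcs remains.
  walkChain : ∀ {u v} → Star (Step s t c) u v → WalkChain u v
  walkChain {u} ε = (λ _ → 0#) , (λ _ → refl) ,
    λ P → trans (sum-zero {m} λ _ → zeroˡ _) (sym (-‿inverseʳ (P u)))
  walkChain {u} {v} (_◅_ {j = w} st p) = (λ e → y e + x e) ,
    (λ ce → trans (cong₂ _+_ (y-supp ce) (x-supp ce)) (+-identityˡ 0#)) ,
    λ P → trans (∂-+ y x P) (trans (cong₂ _+_ (∂y P) (∂x P)) (telescope (P u) (P w) (P v)))
    where
    x = proj₁ (walkChain p)
    x-supp = proj₁ (proj₂ (walkChain p))
    ∂x = proj₂ (proj₂ (walkChain p))
    δ-supp : ∀ {e} → c e ≡ true → SupportedOn (δ e)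
    δ-supp {e} ce {e′} ce′ = δ-off {i = e} {e′} λ { refl → contradiction (trans (sym ce) ce′) λ () }
    single : ∀ {u w} → Step s t c u w → WalkChain u w
    single (forth {e} ce) = δ e , (λ {e′} → δ-supp ce {e′}) , ∂-δ e
    single (back {e} ce) = (λ e′ → - 1# · δ e e′) ,
      (λ {e′} ce′ → trans (cong (- 1# ·_) (δ-supp ce {e′} ce′)) (zeroʳ _)) ,
      λ P → trans (∂-* (- 1#) (δ e) P) (trans (cong (- 1# ·_) (∂-δ e P))
        (trans (-1*x≈-x _) (trans (-‿anti-homo-+ (P (t e)) (- P (s e)))
          (cong (_- P (t e)) (-‿involutive (P (s e)))))))
    y = proj₁ (single st)
    y-supp = proj₁ (proj₂ (single st))
    ∂y = proj₂ (proj₂ (single st))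

-- Integer flows and their binary digits

odd : ℕ → Bool
odd zero = false
odd (suc j) = not (odd j)

odd-+ : ∀ i j → odd (i ℕ.+ j) ≡ odd i xor odd j
odd-+ zero j = refl
odd-+ (suc i) j = trans (cong not (odd-+ i j)) (Bool.not-distribˡ-xor (odd i) (odd j))

odd-* : ∀ i j → odd (i ℕ.* j) ≡ odd i ∧ odd j
odd-* zero j = refl
odd-* (suc i) j = trans (odd-+ j (i ℕ.* j)) (trans (cong (odd j xor_) (odd-* i j)) (absorb (odd i) (odd j)))
  where
  absorb : ∀ b b′ → b′ xor (b ∧ b′) ≡ not b ∧ b′
  absorb false b′ = xor-identityʳ b′
  absorb true b′ = xor-same b′

even-half : ∀ i → odd i ≡ false → ∃[ j ] i ≡ 2 ℕ.* j
even-half zero _ = 0 , refl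
even-half (suc (suc i)) e = let j , i≡ = even-half i (trans (sym (not-involutive (odd i))) e) in
  suc j , trans (cong (λ a → suc (suc a)) i≡) (sym (ℕ.*-suc 2 j))

parity : ℤ → Bool
parity i = odd ℤ.∣ i ∣

parity-⊖ : ∀ i j → parity (i ℤ.⊖ j) ≡ odd i xor odd j
parity-⊖ i zero = sym (xor-identityʳ (odd i))
parity-⊖ zero (suc j) = refl
parity-⊖ (suc i) (suc j) = trans (cong parity (ℤ.[1+m]⊖[1+n]≡m⊖n i j))
  (trans (parity-⊖ i j) (sym (Bool.xor-annihilates-not (odd i) (odd j))))

parity-+ : ∀ i j → parity (i ℤ.+ j) ≡ parity i xor parity j
parity-+ (ℤ.+ i) (ℤ.+ j) = odd-+ i j
parity-+ (ℤ.+ i) ℤ.-[1+ j ] = parity-⊖ i (suc j)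
parity-+ ℤ.-[1+ i ] (ℤ.+ j) = trans (parity-⊖ j (suc i)) (xor-comm (odd j) (odd (suc i)))
parity-+ ℤ.-[1+ i ] ℤ.-[1+ j ] =
  trans (not-involutive (odd (i ℕ.+ j))) (trans (odd-+ i j) (sym (Bool.xor-annihilates-not (odd i) (odd j))))

parity-- : ∀ i j → parity (i ℤ.- j) ≡ parity i xor parity j
parity-- i j = trans (parity-+ i (ℤ.- j)) (cong (λ a → parity i xor odd a) (ℤ.∣-i∣≡∣i∣ j))

parity-* : ∀ i j → parity (i ℤ.* j) ≡ parity i ∧ parity j
parity-* i j = trans (cong odd (ℤ.abs-* i j)) (odd-* ℤ.∣ i ∣ ℤ.∣ j ∣)

parity-sum : (f : Fin k → ℤ) → parity (ℤᶜ.sum f) ≡ 𝔹.sum (parity ∘ f)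
parity-sum {zero} f = refl
parity-sum {suc k} f = trans (parity-+ (f zero) (ℤᶜ.sum (f ∘ suc)))
  (cong (parity (f zero) xor_) (parity-sum (f ∘ suc)))

parity-half : ∀ i → parity i ≡ false → ∃[ j ] i ≡ ℤ.+ 2 ℤ.* j
parity-half (ℤ.+ i) even = let j , i≡ = even-half i even in
  ℤ.+ j , trans (cong ℤ.+_ i≡) (ℤ.pos-* 2 j)
parity-half ℤ.-[1+ i ] even = let j , i≡ = even-half (suc i) even in
  ℤ.- (ℤ.+ j) , trans (cong (λ a → ℤ.- (ℤ.+ a)) i≡)
    (trans (cong ℤ.-_ (ℤ.pos-* 2 j)) (ℤ.neg-distribʳ-* (ℤ.+ 2) (ℤ.+ j)))

double≡0 : ∀ {i} → ℤ.+ 2 ℤ.* i ≡ 0ℤ → i ≡ 0ℤ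
double≡0 {i} eq with ℤ.i*j≡0⇒i≡0∨j≡0 (ℤ.+ 2) eq
... | inj₂ i≡0 = i≡0

bit : Bool → ℤ
bit b = if b then 1ℤ else 0ℤ

parity-bit : ∀ b → parity (bit b) ≡ b
parity-bit false = refl
parity-bit true = refl

parity-signed : ∀ o b → parity (signed o b) ≡ b
parity-signed o false = refl
parity-signed false true = refl
parity-signed true true = refl

-- Parity is a ring homomorphism, and a Boolean test function `Q` lifts to the integer function
-- `bit ∘ Q`, on which the integer boundary vanishes.
parity-cycle : (s t : Fin m → Fin n) (f : Fin m → ℤ) →
  ℤᶜ.Boundary.IsCycle s t f → 𝔹.Boundary.IsCycle s t (parity ∘ f)
parity-cycle {m} s t f cyc Q = begin
  𝔹.Boundary.∂ s t (parity ∘ f) Q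
    ≡⟨ 𝔹.sum-cong-≗ term ⟨
  𝔹.sum (λ e → parity (f e ℤ.* (bit (Q (t e)) ℤ.- bit (Q (s e)))))
    ≡⟨ parity-sum {m} (λ e → f e ℤ.* (bit (Q (t e)) ℤ.- bit (Q (s e)))) ⟨
  parity (ℤᶜ.Boundary.∂ s t f (bit ∘ Q))
    ≡⟨ cong parity (cyc (bit ∘ Q)) ⟩
  false ∎
  where
  open ≡-Reasoning
  term : ∀ e → parity (f e ℤ.* (bit (Q (t e)) ℤ.- bit (Q (s e)))) ≡ parity (f e) ∧ (Q (t e) xor Q (s e))
  term e = trans (parity-* (f e) _) (cong (parity (f e) ∧_)
    (trans (parity-- (bit (Q (t e))) (bit (Q (s e)))) (cong₂ _xor_ (parity-bit (Q (t e))) (parity-bit (Q (s e))))))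

-- An integer flow with values in {0, ±1, ±2, ±3} amounts to a ℤ₂ × ℤ₂-flow
-- (g₁ , g₂) together with orientations: it is ±g₁ + 2 (±g₂).
BinaryDigits : (s t : Fin m → Fin n) (f : Fin m → ℤ) → Set
BinaryDigits {m} s t f = Σ[ g₁ ∈ (Fin m → Bool) ] Σ[ g₂ ∈ (Fin m → Bool) ]
  𝔹.Boundary.IsCycle s t g₁ × 𝔹.Boundary.IsCycle s t g₂ ×
  (∀ {e} → f e ≡ 0ℤ → g₁ e ∨ g₂ e ≡ false) ×
  (∀ {e} → f e ≢ 0ℤ → ℤ.∣ f e ∣ ℕ.< 4 → g₁ e ∨ g₂ e ≡ true)

-- If both digits vanish, then `i` is twice an even number, and the only multiple of 4 of absolute
-- value below 4 is 0.
digits-nonzero : ∀ {o i j} → i ℤ.- signed o (parity i) ≡ ℤ.+ 2 ℤ.* j →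
  i ≢ 0ℤ → ℤ.∣ i ∣ ℕ.< 4 → parity i ∨ parity j ≡ true
digits-nonzero {o} {i} {j} eq i≢0 i<4 = first (parity i) refl
  where
  second : i ≡ ℤ.+ 2 ℤ.* j → ∀ b → parity j ≡ b → b ≡ true
  second _ true _ = refl
  second i≡2j false pj = contradiction (small ℤ.∣ l ∣ refl) i≢0
    where
    l = proj₁ (parity-half j pj)
    i≡4l : i ≡ ℤ.+ 4 ℤ.* l
    i≡4l = trans i≡2j (trans (cong (ℤ.+ 2 ℤ.*_) (proj₂ (parity-half j pj))) (sym (ℤ.*-assoc (ℤ.+ 2) (ℤ.+ 2) l)))
    small : ∀ a → ℤ.∣ l ∣ ≡ a → i ≡ 0ℤ
    small zero ∣l∣≡0 = trans i≡4l (cong (ℤ.+ 4 ℤ.*_) (ℤ.∣i∣≡0⇒i≡0 ∣l∣≡0))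
    small (suc a) ∣l∣≡ = contradiction
      (subst (ℕ._< 4) (trans (cong ℤ.∣_∣ i≡4l) (trans (ℤ.abs-* (ℤ.+ 4) l) (cong (4 ℕ.*_) ∣l∣≡))) i<4)
      (ℕ.≤⇒≯ (ℕ.m≤m*n 4 (suc a)))
  first : ∀ b → parity i ≡ b → b ∨ parity j ≡ true
  first true _ = refl
  first false pi = second (trans (sym (ℤ.+-identityʳ i))
    (trans (cong (λ b → i ℤ.- signed o b) (sym pi)) eq)) (parity j) refl

-- The odd part of `f` is an even subgraph. Subtracting an Eulerian orientation of it leaves a cycle
-- with even values, whose half is again an integer cycle; the parity of that half is the second
-- digit.
binaryDigits : (s t : Fin m → Fin n) (f : Fin m → ℤ) → ℤᶜ.Boundary.IsCycle s t f → BinaryDigits s t f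
binaryDigits {m} {n} s t f cyc = split (signed-even s t (parity ∘ f) (parity-cycle s t f cyc))
  where
  open ℤᶜ.Boundary s t
  open ≡-Reasoning
  split : Orients s t (parity ∘ f) → BinaryDigits s t f
  split (o , y-cycle) = parity ∘ f , parity ∘ half , parity-cycle s t f cyc , parity-cycle s t half half-cycle ,
    (λ {e} fe≡0 → zero-digits (o e) fe≡0 (half-eq e)) ,
    λ {e} → digits-nonzero {o e} (half-eq e)
    where
    y : Fin m → ℤ
    y e = signed (o e) (parity (f e))
    rest-even : ∀ e → parity (f e ℤ.- y e) ≡ false
    rest-even e = trans (parity-- (f e) (y e))
      (trans (cong (parity (f e) xor_) (parity-signed (o e) _)) (xor-same (parity (f e))))
    half : Fin m → ℤ
    half e = proj₁ (parity-half (f e ℤ.- y e) (rest-even e))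
    half-eq : ∀ e → f e ℤ.- y e ≡ ℤ.+ 2 ℤ.* half e
    half-eq e = proj₂ (parity-half (f e ℤ.- y e) (rest-even e))
    zero-digits : ∀ o {i j} → i ≡ 0ℤ → i ℤ.- signed o (parity i) ≡ ℤ.+ 2 ℤ.* j → parity i ∨ parity j ≡ false
    zero-digits o {j = j} refl eq = cong parity (double≡0 {j} (sym eq))
    half-cycle : IsCycle half
    half-cycle P = double≡0 (begin
      ℤ.+ 2 ℤ.* ∂ half P                   ≡⟨ ∂-* (ℤ.+ 2) half P ⟨
      ∂ (λ e → ℤ.+ 2 ℤ.* half e) P         ≡⟨ ∂-cong (λ e → trans (sym (half-eq e))
                                                (cong (λ a → f e ℤ.+ a) (sym (ℤ.-1*i≡-i (y e))))) P ⟩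
      ∂ (λ e → f e ℤ.+ -1ℤ ℤ.* y e) P      ≡⟨ ∂-+ f (λ e → -1ℤ ℤ.* y e) P ⟩
      ∂ f P ℤ.+ ∂ (λ e → -1ℤ ℤ.* y e) P    ≡⟨ cong₂ ℤ._+_ (cyc P) (trans (∂-* -1ℤ y P)
                                                (cong (-1ℤ ℤ.*_) (y-cycle P))) ⟩
      0ℤ                                   ∎)

IsFourFlow : (s t : Fin m → Fin n) (g₁ g₂ : Fin m → Bool) (f : Fin m → ℤ) → Set
IsFourFlow s t g₁ g₂ f = ℤᶜ.Boundary.IsCycle s t f × (∀ e → ℤ.∣ f e ∣ ℕ.< 4) ×
  (∀ e → does (f e ℤ.≟ 0ℤ) ≡ not (g₁ e ∨ g₂ e))

-- Orient both digits separately: ±1, ±2 and ±1 ± 2 are all nonzero and of absolute value at most 3,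
-- whatever the signs.
fromDigits : (s t : Fin m → Fin n) {g₁ g₂ : Fin m → Bool} →
  𝔹.Boundary.IsCycle s t g₁ → 𝔹.Boundary.IsCycle s t g₂ → ∃[ f ] IsFourFlow s t g₁ g₂ f
fromDigits {m} s t {g₁} {g₂} even₁ even₂ = combine (signed-even s t g₁ even₁) (signed-even s t g₂ even₂)
  where
  open ℤᶜ.Boundary s t
  small : ∀ o b o′ b′ → ℤ.∣ signed o b ℤ.+ ℤ.+ 2 ℤ.* signed o′ b′ ∣ ℕ.< 4
  small o false o′ false = ℕ.s≤s ℕ.z≤n
  small o false false true = ℕ.s≤s (ℕ.s≤s (ℕ.s≤s ℕ.z≤n))
  small o false true true = ℕ.s≤s (ℕ.s≤s (ℕ.s≤s ℕ.z≤n))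
  small false true o′ false = ℕ.s≤s (ℕ.s≤s ℕ.z≤n)
  small true true o′ false = ℕ.s≤s (ℕ.s≤s ℕ.z≤n)
  small false true false true = ℕ.s≤s (ℕ.s≤s (ℕ.s≤s (ℕ.s≤s ℕ.z≤n)))
  small false true true true = ℕ.s≤s (ℕ.s≤s ℕ.z≤n)
  small true true false true = ℕ.s≤s (ℕ.s≤s ℕ.z≤n)
  small true true true true = ℕ.s≤s (ℕ.s≤s (ℕ.s≤s (ℕ.s≤s ℕ.z≤n)))
  zeros : ∀ o b o′ b′ → does (signed o b ℤ.+ ℤ.+ 2 ℤ.* signed o′ b′ ℤ.≟ 0ℤ) ≡ not (b ∨ b′)
  zeros o false o′ false = refl
  zeros o false false true = refl
  zeros o false true true = refl
  zeros false true o′ false = refl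
  zeros true true o′ false = refl
  zeros false true false true = refl
  zeros false true true true = refl
  zeros true true false true = refl
  zeros true true true true = refl
  combine : Orients s t g₁ → Orients s t g₂ → ∃[ f ] IsFourFlow s t g₁ g₂ f
  combine (o₁ , cyc₁) (o₂ , cyc₂) = (λ e → y₁ e ℤ.+ ℤ.+ 2 ℤ.* y₂ e) ,
    (λ P → trans (∂-+ y₁ (λ e → ℤ.+ 2 ℤ.* y₂ e) P)
      (cong₂ ℤ._+_ (cyc₁ P) (trans (∂-* (ℤ.+ 2) y₂ P) (cong (ℤ.+ 2 ℤ.*_) (cyc₂ P))))) ,
    (λ e → small (o₁ e) (g₁ e) (o₂ e) (g₂ e)) ,
    λ e → zeros (o₁ e) (g₁ e) (o₂ e) (g₂ e)
    where
    y₁ y₂ : Fin m → ℤ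
    y₁ e = signed (o₁ e) (g₁ e)
    y₂ e = signed (o₂ e) (g₂ e)

-- An integer, so that class sizes can be subtracted and compared with signed sums.
count : (Fin k → Bool) → ℤ
count p = ℤᶜ.sum (bit ∘ p)

∣tabulate∣ : (p : Fin k → Bool) → ℤ.+ ∣ tabulate p ∣ ≡ count p
∣tabulate∣ {zero} p = refl
∣tabulate∣ {suc k} p with p zero
... | true = cong ℤ.suc (∣tabulate∣ (p ∘ suc))
... | false = trans (∣tabulate∣ (p ∘ suc)) (sym (ℤ.+-identityˡ _))

-- Balanced flows on an oriented circuit

module Circuit {m n} (s t : Fin m → Fin n) (c : Fin m → Bool) (inV : Fin n → Bool)
  (s∈V : ∀ {e} → c e ≡ true → inV (s e) ≡ true)
  (t∈V : ∀ {e} → c e ≡ true → inV (t e) ≡ true)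
  (outE : ∀ {v} → inV v ≡ true → UniqueAt c s v)
  (inE : ∀ {v} → inV v ≡ true → UniqueAt c t v)
  (connected : ∀ {u v} → inV u ≡ true → inV v ≡ true → Star (Step s t c) u v)
  {r : Fin n} (r∈V : inV r ≡ true) where

  private
    module Z where
      open ℤᶜ.Boundary s t public
      open ChainsOnCircuit ℤ.+-*-isCommutativeRing s t c public
    module Q where
      open 𝔹.Boundary s t public
      open ChainsOnCircuit (CommutativeRing.isCommutativeRing xor-∧-commutativeRing) s t c public
    out in′ : ∀ {v} → inV v ≡ true → Fin m
    out = UniqueAt.edge ∘ outE
    in′ = UniqueAt.edge ∘ inE

  -- At a vertex of the circuit the boundary of `z` is its value on the entering edge minus its
  -- value on the leaving edge, so consecutive edges carry equal values; connectedness does the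
  -- rest.
  cycle-constant : ∀ {z} → Z.SupportedOn z → Z.IsCycle z →
    ∀ {e e′} → c e ≡ true → c e′ ≡ true → z e ≡ z e′
  cycle-constant {z} supp cyc ce ce′ = trans (at-tail ce (s∈V ce))
    (trans (along (connected (s∈V ce) (s∈V ce′)) (s∈V ce) (s∈V ce′)) (sym (at-tail ce′ (s∈V ce′))))
    where
    at-tail : ∀ {e} → c e ≡ true → (s∈ : inV (s e) ≡ true) → z e ≡ z (out s∈)
    at-tail ce s∈ = cong z (UniqueAt.unique (outE s∈) ce refl)
    at-head : ∀ {e} → c e ≡ true → (t∈ : inV (t e) ≡ true) → z e ≡ z (out t∈)
    at-head {e} ce t∈ = trans (cong z (UniqueAt.unique (inE t∈) ce refl))
      (ℤ.i-j≡0⇒i≡j _ _ (trans (sym (Z.∂-at supp (inE t∈) (outE t∈))) (cyc (ℤᶜ.δ (t e)))))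
    along : ∀ {u v} → Star (Step s t c) u v → (u∈ : inV u ≡ true) (v∈ : inV v ≡ true) →
      z (out u∈) ≡ z (out v∈)
    along ε u∈ v∈ = cong z (UniqueAt.unique (outE v∈) (UniqueAt.edge∈c (outE u∈)) (UniqueAt.edge-at (outE u∈)))
    along (forth ce ◅ p) u∈ v∈ =
      trans (trans (sym (at-tail ce u∈)) (at-head ce (t∈V ce))) (along p (t∈V ce) v∈)
    along (back ce ◅ p) u∈ v∈ =
      trans (trans (sym (at-head ce u∈)) (at-tail ce (s∈V ce))) (along p (s∈V ce) v∈)

  Potential : (Fin m → ℤ) → (Fin n → ℤ) → Set
  Potential y F = ∀ {e} → c e ≡ true → F (t e) ℤ.- F (s e) ≡ y e

  -- `F v` is the integral of `y` along some walk `χ v` from the root. Another choice of walk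
  -- changes the chain by a multiple of the whole circuit, along which `y` adds up to 0, so `F` can
  -- be compared at the two ends of an edge.
  potential : ∀ {y} → Z.SupportedOn y → ℤᶜ.sum y ≡ 0ℤ → Σ[ F ∈ (Fin n → ℤ) ] Potential y F
  potential {y} supp Σy≡0 = (λ v → F v) , difference
    where
    -- Vertices off the circuit get the chain 0 as a default; `Potential` only speaks of vertices on
    -- the circuit.
    fromRoot : ∀ v b → inV v ≡ b → Σ[ x ∈ (Fin m → ℤ) ] Z.SupportedOn x ×
      (inV v ≡ true → ∀ (P : Fin n → ℤ) → Z.∂ x P ≡ P v ℤ.- P r)
    fromRoot v true v∈V = let x , supp , ∂x = Z.walkChain (connected r∈V v∈V) in x , supp , λ _ → ∂x
    fromRoot v false v∉V = (λ _ → 0ℤ) , (λ _ → refl) , λ v∈V → contradiction (trans (sym v∈V) v∉V) λ ()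
    χ : Fin n → Fin m → ℤ
    χ v = proj₁ (fromRoot v (inV v) refl)
    χ-supp : ∀ v → Z.SupportedOn (χ v)
    χ-supp v = proj₁ (proj₂ (fromRoot v (inV v) refl))
    ∂χ : ∀ {v} → inV v ≡ true → ∀ (P : Fin n → ℤ) → Z.∂ (χ v) P ≡ P v ℤ.- P r
    ∂χ {v} = proj₂ (proj₂ (fromRoot v (inV v) refl))
    F : Fin n → ℤ
    F v = ℤᶜ.sum λ e → χ v e ℤ.* y e
    difference : Potential y F
    difference {e} ce = begin
      F (t e) ℤ.- F (s e)
        ≡⟨ ℤᶜ.sum-- {m} _ _ ⟨
      ℤᶜ.sum (λ e′ → χ (t e) e′ ℤ.* y e′ ℤ.- χ (s e) e′ ℤ.* y e′)
        ≡⟨ ℤᶜ.sum-cong-≗ (λ e′ → split e′ (c e′) refl) ⟩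
      ℤᶜ.sum (λ e′ → z e ℤ.* y e′ ℤ.+ y e′ ℤ.* ℤᶜ.δ e′ e)
        ≡⟨ ℤᶜ.∑-distrib-+ {m} _ _ ⟩
      ℤᶜ.sum (λ e′ → z e ℤ.* y e′) ℤ.+ ℤᶜ.sum (λ e′ → y e′ ℤ.* ℤᶜ.δ e′ e)
        ≡⟨ cong₂ ℤ._+_ (sym (ℤᶜ.*-distribˡ-sum {m} (z e) y)) (ℤᶜ.sum-δ y e) ⟩
      z e ℤ.* ℤᶜ.sum y ℤ.+ y e
        ≡⟨ cong (λ a → z e ℤ.* a ℤ.+ y e) Σy≡0 ⟩
      z e ℤ.* 0ℤ ℤ.+ y e
        ≡⟨ cong (ℤ._+ y e) (ℤ.*-zeroʳ (z e)) ⟩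
      0ℤ ℤ.+ y e
        ≡⟨ ℤ.+-identityˡ (y e) ⟩
      y e ∎
      where
      open ≡-Reasoning
      -- The closed walk from the root to `t e`, back over `e` to `s e`, and back to the root. By
      -- `cycle-constant` its coefficient on any circuit edge is `z e`.
      z : Fin m → ℤ
      z e′ = χ (t e) e′ ℤ.+ -1ℤ ℤ.* (χ (s e) e′ ℤ.+ ℤᶜ.δ e e′)
      δ-supp : Z.SupportedOn (ℤᶜ.δ e)
      δ-supp {e′} ce′ = ℤᶜ.δ-off {i = e} {e′} λ { refl → contradiction (trans (sym ce) ce′) λ () }
      z-supp : Z.SupportedOn z
      z-supp {e′} ce′ = cong₂ (λ a b → a ℤ.+ -1ℤ ℤ.* b) (χ-supp (t e) ce′)
        (cong₂ ℤ._+_ (χ-supp (s e) ce′) (δ-supp {e′} ce′))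
      z-cycle : Z.IsCycle z
      z-cycle P = begin
        Z.∂ z P
          ≡⟨ Z.∂-+ (χ (t e)) (λ e′ → -1ℤ ℤ.* (χ (s e) e′ ℤ.+ ℤᶜ.δ e e′)) P ⟩
        Z.∂ (χ (t e)) P ℤ.+ Z.∂ (λ e′ → -1ℤ ℤ.* (χ (s e) e′ ℤ.+ ℤᶜ.δ e e′)) P
          ≡⟨ cong₂ ℤ._+_ (∂χ (t∈V ce) P) (trans (Z.∂-* -1ℤ (λ e′ → χ (s e) e′ ℤ.+ ℤᶜ.δ e e′) P) (cong (-1ℤ ℤ.*_)
               (trans (Z.∂-+ (χ (s e)) (ℤᶜ.δ e) P) (cong₂ ℤ._+_ (∂χ (s∈V ce) P) (Z.∂-δ e P))))) ⟩
        (P (t e) ℤ.- P r) ℤ.+ -1ℤ ℤ.* ((P (s e) ℤ.- P r) ℤ.+ (P (t e) ℤ.- P (s e)))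
          ≡⟨ cancel (P (t e)) (P (s e)) (P r) ⟩
        0ℤ ∎
        where
        cancel : ∀ a b d → (a ℤ.- d) ℤ.+ -1ℤ ℤ.* ((b ℤ.- d) ℤ.+ (a ℤ.- b)) ≡ 0ℤ
        cancel = solve-∀
      δ-comm : ∀ e′ → ℤᶜ.δ e e′ ≡ ℤᶜ.δ e′ e
      δ-comm e′ with e′ ≟ e | e ≟ e′
      ... | yes _ | yes _ = refl
      ... | no _  | no _  = refl
      ... | yes refl | no e≢e = contradiction refl e≢e
      ... | no e≢e | yes refl = contradiction refl e≢e
      split : ∀ e′ b → c e′ ≡ b → χ (t e) e′ ℤ.* y e′ ℤ.- χ (s e) e′ ℤ.* y e′ ≡
        z e ℤ.* y e′ ℤ.+ y e′ ℤ.* ℤᶜ.δ e′ e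
      split e′ true ce′ = trans (regroup (χ (t e) e′) (χ (s e) e′) (ℤᶜ.δ e e′) (y e′))
        (cong₂ (λ a b → a ℤ.* y e′ ℤ.+ y e′ ℤ.* b) (cycle-constant {z} z-supp z-cycle ce′ ce) (δ-comm e′))
        where
        regroup : ∀ a b d w → a ℤ.* w ℤ.- b ℤ.* w ≡ (a ℤ.+ -1ℤ ℤ.* (b ℤ.+ d)) ℤ.* w ℤ.+ w ℤ.* d
        regroup = solve-∀
      split e′ false ce′ = trans
        (cong (λ w → χ (t e) e′ ℤ.* w ℤ.- χ (s e) e′ ℤ.* w) (supp ce′))
        (trans (vanish (χ (t e) e′) (χ (s e) e′) (z e) (ℤᶜ.δ e′ e))
        (cong (λ w → z e ℤ.* w ℤ.+ w ℤ.* ℤᶜ.δ e′ e) (sym (supp ce′))))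
        where
        vanish : ∀ a b d w → a ℤ.* 0ℤ ℤ.- b ℤ.* 0ℤ ≡ d ℤ.* 0ℤ ℤ.+ 0ℤ ℤ.* w
        vanish = solve-∀

  maximum : (F : Fin n → ℤ) → Σ[ p ∈ Fin n ] inV p ≡ true × (∀ {v} → inV v ≡ true → F v ℤ.≤ F p)
  maximum F = argmax F r vs , argmax-all F r∈V (all-filter (λ v → inV v Bool.≟ true) (allFin n)) ,
    λ {v} v∈V → lookup (f[xs]≤f[argmax] {f = F} r vs) (∈-filter⁺ (λ v → inV v Bool.≟ true) (∈-allFin v) v∈V)
    where vs = filter (λ v → inV v Bool.≟ true) (allFin n)

  -- Signs and turns of a flow along the circuit

  weight : (Fin m → Bool) → Fin m → ℤ
  weight g e = if c e then (if g e then -1ℤ else 1ℤ) else 0ℤ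

  -- These are the vertices at which `g` differs between the entering and the leaving circuit edge.
  -- As a boundary, this is additive in `g` and false off the circuit.
  turns : (Fin m → Bool) → Fin n → Bool
  turns g v = Q.∂ (λ e → c e ∧ g e) (𝔹.δ v)

  turns-at : ∀ g {v} (v∈ : inV v ≡ true) → turns g v ≡ g (in′ v∈) xor g (out v∈)
  turns-at g v∈ = trans (Q.∂-at (λ {e} ce → cong (_∧ g e) ce) (inE v∈) (outE v∈))
    (cong₂ (λ a b → (a ∧ g (in′ v∈)) xor (b ∧ g (out v∈)))
      (UniqueAt.edge∈c (inE v∈)) (UniqueAt.edge∈c (outE v∈)))

  odd⇒∈V : ∀ {x v} → Q.SupportedOn x → Q.∂ x (𝔹.δ v) ≡ true → inV v ≡ true
  odd⇒∈V {x} {v} supp odd with odd-end s t x v odd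
  ... | e , d , xe , e-at-v , _ = onC (c e) refl
    where
    ends∈V : ∀ d → c e ≡ true → inV (side d s t e) ≡ true
    ends∈V true = s∈V
    ends∈V false = t∈V
    onC : ∀ b → c e ≡ b → inV v ≡ true
    onC true ce = trans (cong inV (sym e-at-v)) (ends∈V d ce)
    onC false ce = contradiction (trans (sym xe) (supp ce)) λ ()

  weight-on : ∀ g {e} → c e ≡ true → weight g e ≡ (if g e then -1ℤ else 1ℤ)
  weight-on g {e} ce = cong (if_then (if g e then -1ℤ else 1ℤ) else 0ℤ) ce

  -- The increments of `F` are ±1, never 0. The edge entering a maximum must go up and the one
  -- leaving it must go down, so `g` is false on the first and true on the second.
  maximum-turns : ∀ g {F p} → Potential (weight g) F →
    inV p ≡ true → (∀ {v} → inV v ≡ true → F v ℤ.≤ F p) → turns g p ≡ true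
  maximum-turns g {F} {p} pot p∈ max = trans (turns-at g p∈)
    (cong₂ _xor_ (down (inE p∈) (g (in′ p∈)) refl) (up (outE p∈) (g (out p∈)) refl))
    where
    up : (o : UniqueAt c s p) → ∀ b → g (UniqueAt.edge o) ≡ b → b ≡ true
    up o true _ = refl
    up o false go = contradiction (subst (ℤ._≤ 0ℤ) rise (ℤ.i≤j⇒i-j≤0 (max (t∈V edge∈c)))) λ { (ℤ.+≤+ ()) }
      where
      open UniqueAt o
      rise : F (t edge) ℤ.- F p ≡ 1ℤ
      rise = trans (cong (λ v → F (t edge) ℤ.- F v) (sym edge-at))
        (trans (pot edge∈c) (trans (weight-on g edge∈c) (cong (if_then -1ℤ else 1ℤ) go)))
    down : (i : UniqueAt c t p) → ∀ b → g (UniqueAt.edge i) ≡ b → b ≡ false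
    down i false _ = refl
    down i true gi = contradiction (subst (0ℤ ℤ.≤_) fall (ℤ.i≤j⇒0≤j-i (max (s∈V edge∈c)))) λ ()
      where
      open UniqueAt i
      fall : F p ℤ.- F (s edge) ≡ -1ℤ
      fall = trans (cong (λ v → F v ℤ.- F (s edge)) (sym edge-at))
        (trans (pot edge∈c) (trans (weight-on g edge∈c) (cong (if_then -1ℤ else 1ℤ) gi)))

  -- An arc a from p to q on the circuit has signed boundary ±(q - p), so the
  -- increments of F along it add up to ±(F q - F p).
  arc-balanced : ∀ {F y p q} (a : Fin m → Bool) → Potential y F → Q.SupportedOn a →
    (∀ P → Q.∂ a P ≡ P q xor P p) → p ≢ q → inV q ≡ true →
    ℤᶜ.sum (λ e → bit (a e) ℤ.* y e) ≡ 0ℤ → F q ≡ F p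
  arc-balanced {F} {y} {p} {q} a pot supp ∂a p≢q q∈ Σ≡0 =
    conclude (ℤ.i*j≡0⇒i≡0∨j≡0 (F q ℤ.- F p) product≡0)
    where
    open ≡-Reasoning
    bit-supp : Z.SupportedOn (bit ∘ a)
    bit-supp ce = cong bit (supp ce)
    d : Fin n → ℤ
    d v = Z.∂ (bit ∘ a) (ℤᶜ.δ v)
    d-at : ∀ {v} (v∈ : inV v ≡ true) → d v ≡ bit (a (in′ v∈)) ℤ.- bit (a (out v∈))
    d-at v∈ = Z.∂-at bit-supp (inE v∈) (outE v∈)
    a-at : ∀ {v} (v∈ : inV v ≡ true) → a (in′ v∈) xor a (out v∈) ≡ 𝔹.δ v q xor 𝔹.δ v p
    a-at v∈ = trans (sym (Q.∂-at supp (inE v∈) (outE v∈))) (∂a (𝔹.δ _))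
    bits-equal : ∀ b b′ → b xor b′ ≡ false → bit b ℤ.- bit b′ ≡ 0ℤ
    bits-equal false false _ = refl
    bits-equal true true _ = refl
    bits-differ : ∀ b b′ → b xor b′ ≡ true → bit b ℤ.- bit b′ ≢ 0ℤ
    bits-differ false true _ ()
    bits-differ true false _ ()
    dq≢0 : d q ≢ 0ℤ
    dq≢0 dq≡0 = bits-differ (a (in′ q∈)) (a (out q∈)) (trans (a-at q∈) (cong₂ _xor_ (𝔹.δ-diag q) (𝔹.δ-off p≢q)))
      (trans (sym (d-at q∈)) dq≡0)
    d-off : ∀ v → v ≢ p → v ≢ q → ∀ b → inV v ≡ b → d v ≡ 0ℤ
    d-off v v≢p v≢q true v∈ = trans (d-at v∈) (bits-equal (a (in′ v∈)) (a (out v∈))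
      (trans (a-at v∈) (cong₂ _xor_ (𝔹.δ-off (v≢q ∘ sym)) (𝔹.δ-off (v≢p ∘ sym)))))
    d-off v v≢p v≢q false v∉ = ℤᶜ.sum-zero λ e → off e (c e) refl
      where
      off : ∀ e b → c e ≡ b → bit (a e) ℤ.* (ℤᶜ.δ v (t e) ℤ.- ℤᶜ.δ v (s e)) ≡ 0ℤ
      off e false ce = cong (ℤ._* (ℤᶜ.δ v (t e) ℤ.- ℤᶜ.δ v (s e))) (bit-supp ce)
      off e true ce = trans
        (cong₂ (λ i j → bit (a e) ℤ.* (i ℤ.- j))
          (ℤᶜ.δ-off λ te≡v → contradiction (trans (sym (t∈V ce)) (trans (cong inV te≡v) v∉)) λ ())
          (ℤᶜ.δ-off λ se≡v → contradiction (trans (sym (s∈V ce)) (trans (cong inV se≡v) v∉)) λ ()))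
        (ℤ.*-zeroʳ (bit (a e)))
    -- The 0/1 chain `bit ∘ a` has nonzero boundary at most at `p` and `q`, since elsewhere the
    -- entering and leaving edges are both in `a` or both not. Shifting `F` to vanish at `p` leaves
    -- `q` as the only contribution, with a nonzero coefficient.
    G : Fin n → ℤ
    G v = F v ℤ.- F p
    increment : ∀ e b → c e ≡ b → bit (a e) ℤ.* (G (t e) ℤ.- G (s e)) ≡ bit (a e) ℤ.* y e
    increment e true ce = cong (bit (a e) ℤ.*_) (trans (shift (F (t e)) (F (s e)) (F p)) (pot ce))
      where
      shift : ∀ i j k → (i ℤ.- k) ℤ.- (j ℤ.- k) ≡ i ℤ.- j
      shift = solve-∀
    increment e false ce = trans (cong (ℤ._* (G (t e) ℤ.- G (s e))) (bit-supp ce))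
      (cong (ℤ._* y e) (sym (bit-supp ce)))
    vanish : ∀ v → v ≢ q → G v ℤ.* d v ≡ 0ℤ
    vanish v v≢q with v ≟ p
    ... | yes v≡p = cong (ℤ._* d v) (trans (cong G v≡p) (ℤ.+-inverseʳ (F p)))
    ... | no v≢p = trans (cong (G v ℤ.*_) (d-off v v≢p v≢q (inV v) refl)) (ℤ.*-zeroʳ (G v))
    product≡0 : (F q ℤ.- F p) ℤ.* d q ≡ 0ℤ
    product≡0 = begin
      G q ℤ.* d q                       ≡⟨ ℤᶜ.sum-single q vanish ⟨
      ℤᶜ.sum (λ v → G v ℤ.* d v)        ≡⟨ Z.∂-expand (bit ∘ a) G ⟨
      Z.∂ (bit ∘ a) G                   ≡⟨ ℤᶜ.sum-cong-≗ (λ e → increment e (c e) refl) ⟩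
      ℤᶜ.sum (λ e → bit (a e) ℤ.* y e)  ≡⟨ Σ≡0 ⟩
      0ℤ                                ∎
    conclude : F q ℤ.- F p ≡ 0ℤ ⊎ d q ≡ 0ℤ → F q ≡ F p
    conclude (inj₁ eq) = ℤ.i-j≡0⇒i≡j _ _ eq
    conclude (inj₂ eq) = contradiction eq dq≢0

  -- Here `u` stands for the edge set of the graph: off the circuit the pair is nonzero exactly on
  -- edges. On the circuit it may take any values.
  record Cover (u g₁ g₂ : Fin m → Bool) : Set where
    field
      even₁  : Q.IsCycle g₁
      even₂  : Q.IsCycle g₂
      covers : ∀ {e} → c e ≡ false → g₁ e ∨ g₂ e ≡ u e

  infixl 6 _⊞_
  _⊞_ : (Fin m → Bool) → (Fin m → Bool) → Fin m → Bool
  (f ⊞ g) e = f e xor g e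

  ⊞-even : ∀ {f g} → Q.IsCycle f → Q.IsCycle g → Q.IsCycle (f ⊞ g)
  ⊞-even {f} {g} f-even g-even P = trans (Q.∂-+ f g P) (cong₂ _xor_ (f-even P) (g-even P))

  -- A change of basis of ℤ₂ × ℤ₂ preserves the zeros of the pair. This one fixes `g₁` and makes the
  -- second coordinate turn wherever `g₁` turns and `g₂` does not.
  shear : ∀ {u g₁ g₂} → Cover u g₁ g₂ → Cover u g₁ (g₁ ⊞ g₂)
  shear {u} {g₁} {g₂} cov = record
    { even₁ = even₁
    ; even₂ = ⊞-even even₁ even₂
    ; covers = λ {e} ce → trans (absorb (g₁ e) (g₂ e)) (covers ce)
    }
    where
    open Cover cov
    absorb : ∀ b b′ → b ∨ (b xor b′) ≡ b ∨ b′
    absorb false b′ = refl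
    absorb true b′ = refl

  turns-⊞ : ∀ f g v → turns (f ⊞ g) v ≡ turns f v xor turns g v
  turns-⊞ f g v = trans (Q.∂-cong (λ e → ∧-distribˡ-xor (c e) (f e) (g e)) (𝔹.δ v))
    (Q.∂-+ (λ e → c e ∧ f e) (λ e → c e ∧ g e) (𝔹.δ v))

  -- Either the goal is reached or the set of turns shrinks. Sets are compared by strict inclusion,
  -- which is well-founded and is what the descent yields directly.
  Progress : (Fin m → Bool) → (Fin m → Bool) → Set
  Progress g g′ = ℤᶜ.sum (weight g′) ≢ 0ℤ ⊎ tabulate (turns g′) ⊂ tabulate (turns g)

  descend-at : ∀ {u g₁ g₂ F p} → Cover u g₁ g₂ → ℤᶜ.sum (weight g₁) ≡ 0ℤ →
    Potential (weight g₁) F → inV p ≡ true → (∀ {v} → inV v ≡ true → F v ℤ.≤ F p) →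
    turns g₂ p ≡ true →
    Σ[ g ∈ (Fin m → Bool) ] Cover u g g₂ × Progress g₁ g
  descend-at {u} {g₁} {g₂} {F} {p} cov balanced pot p∈ max turn₂ =
    descend-along (oddPath s t h p (trans (∂h p) turn₂))
    where
    open Cover cov
    h : Fin m → Bool
    h e = not (c e) ∧ g₂ e
    -- Since `g₂` is even, its parts on and off the circuit have the same boundary. So the odd
    -- vertices of `h` are the turns of `g₂`, which puts `q` on the circuit.
    ∂h : ∀ v → Q.∂ h (𝔹.δ v) ≡ turns g₂ v
    ∂h v = xor≡false _ _ (trans (sym (Q.∂-+ h (λ e → c e ∧ g₂ e) (𝔹.δ v)))
      (trans (Q.∂-cong (λ e → split (c e) (g₂ e)) (𝔹.δ v)) (even₂ (𝔹.δ v))))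
      where
      split : ∀ b b′ → (not b ∧ b′) xor (b ∧ b′) ≡ b′
      split false b′ = xor-identityʳ b′
      split true b′ = refl
      xor≡false : ∀ b b′ → b xor b′ ≡ false → b ≡ b′
      xor≡false false false _ = refl
      xor≡false true true _ = refl
    descend-along : OddPath s t h p → Σ[ g ∈ (Fin m → Bool) ] Cover u g g₂ × Progress g₁ g
    descend-along (q , q≢p , q-odd , x , x⊆h , ∂x) = switch (Q.walkChain (connected p∈ q∈))
      where
      q∈ : inV q ≡ true
      q∈ = odd⇒∈V {λ e → c e ∧ g₂ e} (λ {e} ce → cong (_∧ g₂ e) ce) (trans (sym (∂h q)) q-odd)
      switch : Q.WalkChain p q → Σ[ g ∈ (Fin m → Bool) ] Cover u g g₂ × Progress g₁ g
      switch (a , a-supp , ∂a) = g , g-cover , progress (ℤᶜ.sum (weight g) ℤ.≟ 0ℤ)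
        where
        x-off : ∀ {e} → c e ≡ true → x e ≡ false
        x-off {e} ce with x e in xe
        ... | false = refl
        ... | true = contradiction (trans (sym (x⊆h e xe)) (cong (λ b → not b ∧ g₂ e) ce)) λ ()
        g : Fin m → Bool
        g = g₁ ⊞ (x ⊞ a)
        g-cover : Cover u g g₂
        g-cover = record
          { even₁ = ⊞-even even₁ λ P → trans (Q.∂-+ x a P)
              (trans (cong₂ _xor_ (∂x P) (∂a P)) (xor-same (P q xor P p)))
          ; even₂ = even₂
          ; covers = λ {e} ce → trans (same ce) (covers ce)
          }
          where
          same : ∀ {e} → c e ≡ false → g e ∨ g₂ e ≡ g₁ e ∨ g₂ e
          same {e} ce with x e in xe
          ... | false = cong (λ b → b ∨ g₂ e) (trans (cong (g₁ e xor_) (a-supp ce)) (xor-identityʳ (g₁ e)))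
          ... | true = trans (cong (_ ∨_) g₂e)
            (trans (Bool.∨-zeroʳ _) (sym (trans (cong (g₁ e ∨_) g₂e) (Bool.∨-zeroʳ (g₁ e)))))
            where
            g₂e : g₂ e ≡ true
            g₂e = trans (sym (cong (λ b → not b ∧ g₂ e) ce)) (x⊆h e xe)
        turns-g : ∀ v → turns g v ≡ turns g₁ v xor (𝔹.δ v q xor 𝔹.δ v p)
        turns-g v = trans (turns-⊞ g₁ (x ⊞ a) v) (cong (turns g₁ v xor_)
          (trans (Q.∂-cong (λ e → on e (c e) refl) (𝔹.δ v)) (∂a (𝔹.δ v))))
          where
          on : ∀ e b → c e ≡ b → c e ∧ (x e xor a e) ≡ a e
          on e false ce = trans (cong (_∧ (x e xor a e)) ce) (sym (a-supp ce))
          on e true ce = cong₂ (λ b b′ → b ∧ (b′ xor a e)) ce (x-off ce)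
        -- Where `a` is true the sign is reversed, so the two weights differ there by twice the old
        -- one; elsewhere they agree. The path `x` avoids the circuit and does not enter.
        balance : ℤᶜ.sum (weight g) ≡ 0ℤ → ℤᶜ.sum (λ e → bit (a e) ℤ.* weight g₁ e) ≡ 0ℤ
        balance Σg≡0 = double≡0 (begin
          (ℤ.+ 2) ℤ.* ℤᶜ.sum (λ e → bit (a e) ℤ.* weight g₁ e)
            ≡⟨ ℤᶜ.*-distribˡ-sum {m} (ℤ.+ 2) _ ⟩
          ℤᶜ.sum (λ e → (ℤ.+ 2) ℤ.* (bit (a e) ℤ.* weight g₁ e))
            ≡⟨ ℤᶜ.sum-cong-≗ (λ e → flip e (c e) refl) ⟩
          ℤᶜ.sum (λ e → weight g₁ e ℤ.- weight g e)
            ≡⟨ ℤᶜ.sum-- {m} _ _ ⟩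
          ℤᶜ.sum (weight g₁) ℤ.- ℤᶜ.sum (weight g)
            ≡⟨ cong₂ ℤ._-_ balanced Σg≡0 ⟩
          0ℤ ∎)
          where
          open ≡-Reasoning
          signs : ∀ b b′ → (ℤ.+ 2) ℤ.* (bit b′ ℤ.* (if b then -1ℤ else 1ℤ)) ≡
            (if b then -1ℤ else 1ℤ) ℤ.- (if b xor b′ then -1ℤ else 1ℤ)
          signs false false = refl
          signs false true = refl
          signs true false = refl
          signs true true = refl
          flip : ∀ e b → c e ≡ b → (ℤ.+ 2) ℤ.* (bit (a e) ℤ.* weight g₁ e) ≡ weight g₁ e ℤ.- weight g e
          flip e false ce = trans (cong (λ b → (ℤ.+ 2) ℤ.* (bit b ℤ.* weight g₁ e)) (a-supp ce))
            (sym (cong (λ b → (if b then (if g₁ e then -1ℤ else 1ℤ) else 0ℤ) ℤ.-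
              (if b then (if g e then -1ℤ else 1ℤ) else 0ℤ)) ce))
          flip e true ce = trans (cong (λ w → (ℤ.+ 2) ℤ.* (bit (a e) ℤ.* w)) (weight-on g₁ ce))
            (trans (signs (g₁ e) (a e))
            (sym (cong₂ ℤ._-_ (weight-on g₁ ce)
              (trans (weight-on g ce) (cong (λ b → if g₁ e xor (b xor a e) then -1ℤ else 1ℤ) (x-off ce))))))
        turn-p : turns g₁ p ≡ true
        turn-p = maximum-turns g₁ pot p∈ max
        progress : Dec (ℤᶜ.sum (weight g) ≡ 0ℤ) → Progress g₁ g
        progress (no Σg≢0) = inj₁ Σg≢0
        progress (yes Σg≡0) = inj₂ (tabulate-⊂ (turns g) (turns g₁) fewer p turn-p
          (trans (turns-g p) (cong₂ _xor_ turn-p (cong₂ _xor_ (𝔹.δ-off q≢p) (𝔹.δ-diag p)))))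
          where
          Fq≡Fp : F q ≡ F p
          Fq≡Fp = arc-balanced a pot a-supp ∂a (q≢p ∘ sym) q∈ (balance Σg≡0)
          turn-q : turns g₁ q ≡ true
          turn-q = maximum-turns g₁ pot q∈ λ {v} v∈ → subst (F v ℤ.≤_) (sym Fq≡Fp) (max v∈)
          -- Turns change only at `p` and `q`, and both were turns of `g₁`, so none is gained; the
          -- inclusion is strict at `p`.
          fewer : ∀ v → turns g v ≡ true → turns g₁ v ≡ true
          fewer v turn with v ≟ p | v ≟ q
          ... | yes refl | _ = turn-p
          ... | no _ | yes refl = turn-q
          ... | no v≢p | no v≢q = trans (sym (trans (turns-g v)
            (trans (cong (turns g₁ v xor_) (cong₂ _xor_ (𝔹.δ-off (v≢q ∘ sym)) (𝔹.δ-off (v≢p ∘ sym))))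
              (xor-identityʳ _)))) turn

  Unbalanced : (Fin m → Bool) → Set
  Unbalanced u = Σ[ g ∈ (Fin m → Bool) ] Σ[ g′ ∈ (Fin m → Bool) ]
    Cover u g g′ × ℤᶜ.sum (weight g) ≢ 0ℤ

  unbalance : ∀ {u g₁ g₂} → Cover u g₁ g₂ → Unbalanced u
  unbalance {u} {g₁} {g₂} cov = go cov (⊂-wellFounded (tabulate (turns g₁)))
    where
    go : ∀ {g₁ g₂} → Cover u g₁ g₂ → Acc _⊂_ (tabulate (turns g₁)) → Unbalanced u
    go {g₁} {g₂} cov (acc rec) with ℤᶜ.sum (weight g₁) ℤ.≟ 0ℤ
    ... | no unbalanced = g₁ , g₂ , cov , unbalanced
    ... | yes balanced = choose (turns g₂ p) refl
      where
      pot = potential (λ {e} ce → cong (if_then (if g₁ e then -1ℤ else 1ℤ) else 0ℤ) ce) balanced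
      top = maximum (proj₁ pot)
      p = proj₁ top
      p∈ = proj₁ (proj₂ top)
      p-max = proj₂ (proj₂ top)
      continue : ∀ {g₂} → Σ[ g ∈ (Fin m → Bool) ] Cover u g g₂ × Progress g₁ g → Unbalanced u
      continue {g₂} (g , cov′ , inj₁ unbalanced) = g , g₂ , cov′ , unbalanced
      continue (g , cov′ , inj₂ smaller) = go cov′ (rec smaller)
      choose : ∀ b → turns g₂ p ≡ b → Unbalanced u
      choose true turn₂ = continue (descend-at cov balanced (proj₂ pot) p∈ p-max turn₂)
      choose false turn₂ = continue (descend-at (shear cov) balanced (proj₂ pot) p∈ p-max
        (trans (turns-⊞ g₁ g₂ p) (cong₂ _xor_ (maximum-turns g₁ (proj₂ pot) p∈ p-max) turn₂)))

  -- Shifts along the circuit and the smallest value class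

  circuit-even : Q.IsCycle c
  circuit-even P = trans (Q.∂-expand c P) (𝔹.sum-zero λ v →
    trans (cong (P v ∧_) (even v (Q.∂ c (𝔹.δ v)) refl)) (Bool.∧-zeroʳ (P v)))
    where
    even : ∀ v b → Q.∂ c (𝔹.δ v) ≡ b → Q.∂ c (𝔹.δ v) ≡ false
    even v false odd = odd
    even v true odd = trans (Q.∂-at (λ ce → ce) (inE v∈) (outE v∈))
      (cong₂ _xor_ (UniqueAt.edge∈c (inE v∈)) (UniqueAt.edge∈c (outE v∈)))
      where v∈ = odd⇒∈V (λ ce → ce) odd

  -- On the circuit this is the class where (`g₁` , `g₂`) is (`α` , `β`). It is written as the zero
  -- set of the shifted pair, the form in which `fromDigits` reports zeros.
  zeroClass : (g₁ g₂ : Fin m → Bool) (α β : Bool) → Fin m → Bool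
  zeroClass g₁ g₂ α β e = c e ∧ not ((g₁ e xor (α ∧ c e)) ∨ (g₂ e xor (β ∧ c e)))

  Small : (g₁ g₂ : Fin m → Bool) (α β : Bool) → Set
  Small g₁ g₂ α β = ℤ.+ 4 ℤ.* count (zeroClass g₁ g₂ α β) ℤ.< count c

  small? : ∀ g₁ g₂ α β → Dec (Small g₁ g₂ α β)
  small? g₁ g₂ α β = ℤ.+ 4 ℤ.* count (zeroClass g₁ g₂ α β) ℤ.<? count c

  -- If each class has at least a quarter of the circuit, then each value of `g₁` is taken on at
  -- least half of it, hence on exactly half, and the signs cancel.
  smallClass : ∀ g₁ g₂ → ℤᶜ.sum (weight g₁) ≢ 0ℤ → ∃[ α ] ∃[ β ] Small g₁ g₂ α β
  smallClass g₁ g₂ unbalanced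
    with small? g₁ g₂ false false | small? g₁ g₂ false true
       | small? g₁ g₂ true false | small? g₁ g₂ true true
  ... | yes small | _ | _ | _ = false , false , small
  ... | no _ | yes small | _ | _ = false , true , small
  ... | no _ | no _ | yes small | _ = true , false , small
  ... | no _ | no _ | no _ | yes small = true , true , small
  ... | no ff | no ft | no tf | no tt = contradiction
    (ℤ.≤-antisym (nonpositive (subst₂ ℤ._≤_ refl lower-sum (ℤ.+-mono-≤ (deficit tf) (deficit tt))))
      (ℤ.*-cancelˡ-≤-pos 0ℤ W (ℤ.+ 2) (subst₂ ℤ._≤_ refl upper-sum (ℤ.+-mono-≤ (deficit ff) (deficit ft)))))
    unbalanced
    where
    N : Bool → Bool → ℤ
    N α β = count (zeroClass g₁ g₂ α β)
    W = ℤᶜ.sum (weight g₁)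
    classes : ∀ b x y → bit b ≡
      (bit (b ∧ not ((x xor (false ∧ b)) ∨ (y xor (false ∧ b)))) ℤ.+
       bit (b ∧ not ((x xor (false ∧ b)) ∨ (y xor (true ∧ b))))) ℤ.+
      (bit (b ∧ not ((x xor (true ∧ b)) ∨ (y xor (false ∧ b)))) ℤ.+
       bit (b ∧ not ((x xor (true ∧ b)) ∨ (y xor (true ∧ b)))))
    classes false x y = refl
    classes true false false = refl
    classes true false true = refl
    classes true true false = refl
    classes true true true = refl
    weights : ∀ b x y → (if b then (if x then -1ℤ else 1ℤ) else 0ℤ) ≡
      (bit (b ∧ not ((x xor (false ∧ b)) ∨ (y xor (false ∧ b)))) ℤ.+
       bit (b ∧ not ((x xor (false ∧ b)) ∨ (y xor (true ∧ b))))) ℤ.-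
      (bit (b ∧ not ((x xor (true ∧ b)) ∨ (y xor (false ∧ b)))) ℤ.+
       bit (b ∧ not ((x xor (true ∧ b)) ∨ (y xor (true ∧ b)))))
    weights false x y = refl
    weights true false false = refl
    weights true false true = refl
    weights true true false = refl
    weights true true true = refl
    total : count c ≡ (N false false ℤ.+ N false true) ℤ.+ (N true false ℤ.+ N true true)
    total = trans (ℤᶜ.sum-cong-≗ λ e → classes (c e) (g₁ e) (g₂ e))
      (trans (ℤᶜ.∑-distrib-+ {m} _ _) (cong₂ ℤ._+_ (ℤᶜ.∑-distrib-+ {m} _ _) (ℤᶜ.∑-distrib-+ {m} _ _)))
    balance : W ≡ (N false false ℤ.+ N false true) ℤ.- (N true false ℤ.+ N true true)
    balance = trans (ℤᶜ.sum-cong-≗ λ e → weights (c e) (g₁ e) (g₂ e))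
      (trans (ℤᶜ.sum-- {m} _ _) (cong₂ ℤ._-_ (ℤᶜ.∑-distrib-+ {m} _ _) (ℤᶜ.∑-distrib-+ {m} _ _)))
    deficit : ∀ {α β} → ¬ Small g₁ g₂ α β → 0ℤ ℤ.≤ ℤ.+ 4 ℤ.* N α β ℤ.- count c
    deficit large = ℤ.i≤j⇒0≤j-i (ℤ.≮⇒≥ large)
    -- With |C| replaced by the sum of the four classes, the surplus of the two classes with `g₁`
    -- false is twice the signed sum `W`; `lower-sum` gives its negative for the other two.
    upper-sum : (ℤ.+ 4 ℤ.* N false false ℤ.- count c) ℤ.+ (ℤ.+ 4 ℤ.* N false true ℤ.- count c) ≡ ℤ.+ 2 ℤ.* W
    upper-sum = trans (cong (λ z → (ℤ.+ 4 ℤ.* N false false ℤ.- z) ℤ.+ (ℤ.+ 4 ℤ.* N false true ℤ.- z)) total)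
      (trans (lemma (N false false) (N false true) (N true false) (N true true)) (cong (ℤ.+ 2 ℤ.*_) (sym balance)))
      where
      lemma : ∀ p q r s →
        (ℤ.+ 4 ℤ.* p ℤ.- ((p ℤ.+ q) ℤ.+ (r ℤ.+ s))) ℤ.+ (ℤ.+ 4 ℤ.* q ℤ.- ((p ℤ.+ q) ℤ.+ (r ℤ.+ s))) ≡
        ℤ.+ 2 ℤ.* ((p ℤ.+ q) ℤ.- (r ℤ.+ s))
      lemma = solve-∀
    lower-sum : (ℤ.+ 4 ℤ.* N true false ℤ.- count c) ℤ.+ (ℤ.+ 4 ℤ.* N true true ℤ.- count c) ≡ ℤ.+ 2 ℤ.* (ℤ.- W)
    lower-sum = trans (cong (λ z → (ℤ.+ 4 ℤ.* N true false ℤ.- z) ℤ.+ (ℤ.+ 4 ℤ.* N true true ℤ.- z)) total)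
      (trans (lemma (N false false) (N false true) (N true false) (N true true))
        (cong (λ w → ℤ.+ 2 ℤ.* (ℤ.- w)) (sym balance)))
      where
      lemma : ∀ p q r s →
        (ℤ.+ 4 ℤ.* r ℤ.- ((p ℤ.+ q) ℤ.+ (r ℤ.+ s))) ℤ.+ (ℤ.+ 4 ℤ.* s ℤ.- ((p ℤ.+ q) ℤ.+ (r ℤ.+ s))) ≡
        ℤ.+ 2 ℤ.* (ℤ.- ((p ℤ.+ q) ℤ.- (r ℤ.+ s)))
      lemma = solve-∀
    nonpositive : 0ℤ ℤ.≤ ℤ.+ 2 ℤ.* (ℤ.- W) → W ℤ.≤ 0ℤ
    nonpositive p = subst (ℤ._≤ 0ℤ) (ℤ.neg-involutive W) (ℤ.neg-mono-≤ (ℤ.*-cancelˡ-≤-pos 0ℤ (ℤ.- W) (ℤ.+ 2) p))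

  SparseFlow : (Fin m → Bool) → Set
  SparseFlow u = Σ[ f ∈ (Fin m → ℤ) ] Z.IsCycle f × (∀ e → ℤ.∣ f e ∣ ℕ.< 4) ×
    (∀ {e} → c e ≡ false → does (f e ℤ.≟ 0ℤ) ≡ not (u e)) ×
    4 ℕ.* ∣ tabulate (λ e → c e ∧ does (f e ℤ.≟ 0ℤ)) ∣ ℕ.< ∣ tabulate c ∣

  -- Taking digits forgets the size of `f`, which is only controlled off the circuit. On the circuit
  -- the digits serve as the starting point of the descent.
  sparseFlow : ∀ {u f} → Z.IsCycle f →
    (∀ {e} → c e ≡ false → u e ≡ false → f e ≡ 0ℤ) →
    (∀ {e} → c e ≡ false → u e ≡ true → f e ≢ 0ℤ × ℤ.∣ f e ∣ ℕ.< 4) →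
    SparseFlow u
  sparseFlow {u} {f} cyc outside inside = digits (binaryDigits s t f cyc)
    where
    shift : Unbalanced u → SparseFlow u
    shift (g₁ , g₂ , cov , unbalanced) = rotate (smallClass g₁ g₂ unbalanced)
      where
      open Cover cov
      c-multiple-even : ∀ α → Q.IsCycle (λ e → α ∧ c e)
      c-multiple-even α P = trans (Q.∂-* α c P) (trans (cong (α ∧_) (circuit-even P)) (Bool.∧-zeroʳ α))
      rotate : ∃[ α ] ∃[ β ] Small g₁ g₂ α β → SparseFlow u
      rotate (α , β , small) = orient (fromDigits s t
          (⊞-even even₁ (c-multiple-even α)) (⊞-even even₂ (c-multiple-even β)))
        where
        k₁ k₂ : Fin m → Bool
        k₁ = g₁ ⊞ λ e → α ∧ c e
        k₂ = g₂ ⊞ λ e → β ∧ c e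
        orient : ∃[ f′ ] IsFourFlow s t k₁ k₂ f′ → SparseFlow u
        orient (f′ , f′-cycle , f′<4 , zeros) = f′ , f′-cycle , f′<4 ,
          (λ {e} ce → trans (zeros e) (cong not (trans (off e ce) (covers ce)))) ,
          ℤ.drop‿+<+ (subst₂ ℤ._<_ few (sym (∣tabulate∣ c)) small)
          where
          off : ∀ e → c e ≡ false → k₁ e ∨ k₂ e ≡ g₁ e ∨ g₂ e
          off e ce = cong₂ _∨_ (unchanged α (g₁ e)) (unchanged β (g₂ e))
            where
            unchanged : ∀ α b → b xor (α ∧ c e) ≡ b
            unchanged α b = trans (cong (λ a → b xor (α ∧ a)) ce)
              (trans (cong (b xor_) (Bool.∧-zeroʳ α)) (xor-identityʳ b))
          few : ℤ.+ 4 ℤ.* count (zeroClass g₁ g₂ α β) ≡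
            ℤ.+ (4 ℕ.* ∣ tabulate (λ e → c e ∧ does (f′ e ℤ.≟ 0ℤ)) ∣)
          few = sym (trans (ℤ.pos-* 4 ∣ tabulate (λ e → c e ∧ does (f′ e ℤ.≟ 0ℤ)) ∣) (cong (ℤ.+ 4 ℤ.*_)
            (trans (∣tabulate∣ λ e → c e ∧ does (f′ e ℤ.≟ 0ℤ))
              (ℤᶜ.sum-cong-≗ λ e → cong (λ b → bit (c e ∧ b)) (zeros e)))))
    digits : BinaryDigits s t f → SparseFlow u
    digits (h₁ , h₂ , even₁ , even₂ , zero-digits , nonzero-digits) = shift (unbalance cov)
      where
      cov : Cover u h₁ h₂
      cov = record
        { even₁ = even₁
        ; even₂ = even₂
        ; covers = λ {e} ce → cover (u e) refl ce
        }
        where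
        cover : ∀ {e} b → u e ≡ b → c e ≡ false → h₁ e ∨ h₂ e ≡ u e
        cover false ue ce = trans (zero-digits (outside ce ue)) (sym ue)
        cover true ue ce = trans (nonzero-digits (proj₁ (inside ce ue)) (proj₂ (inside ce ue))) (sym ue)

-- Flows, contractions and circuits

does-∈?-tabulate : (p : Fin k → Bool) (i : Fin k) → does (i ∈? tabulate p) ≡ p i
does-∈?-tabulate p i with i ∈? tabulate p
... | yes i∈p = sym (∈-tabulate⁻ p i∈p)
... | no i∉p with p i in pi
...   | true = contradiction (∈-tabulate⁺ p pi) i∉p
...   | false = refl

does⁻ : {S : Subset k} {i : Fin k} → does (i ∈? S) ≡ true → i ∈ S
does⁻ {S = S} {i} d with i ∈? S
... | yes i∈S = i∈S

x∈p─q⇒x∉q : (p q : Subset k) {i : Fin k} → i ∈ p ─ q → ¬ i ∈ q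
x∈p─q⇒x∉q (_ ∷ p) (true ∷ q) (there i∈) (there i∈q) = x∈p─q⇒x∉q p q i∈ i∈q
x∈p─q⇒x∉q (_ ∷ p) (false ∷ q) (there i∈) (there i∈q) = x∈p─q⇒x∉q p q i∈ i∈q

empty : (p : Fin k → Bool) → ∣ tabulate p ∣ ≡ 0 → ∀ i → p i ≡ false
empty {suc k} p ∣p∣≡0 i with p zero in p₀ | i
... | false | zero = p₀
... | false | suc i = empty (p ∘ suc) ∣p∣≡0 i

singleton : (p : Fin k → Bool) → ∣ tabulate p ∣ ≡ 1 →
  Σ[ i ∈ Fin k ] p i ≡ true × (∀ j → p j ≡ true → j ≡ i)
singleton {suc k} p ∣p∣≡1 with p zero in p₀
... | true = zero , p₀ , only
  where
  only : ∀ j → p j ≡ true → j ≡ zero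
  only zero _ = refl
  only (suc j) pj = contradiction (trans (sym pj) (empty (p ∘ suc) (ℕ.suc-injective ∣p∣≡1) j)) λ ()
... | false = let i , pi , only = singleton (p ∘ suc) ∣p∣≡1 in
  suc i , pi , λ { zero p₀′ → contradiction (trans (sym p₀′) p₀) λ () ; (suc j) pj → cong suc (only j pj) }

bit-∧ : ∀ a b → bit (a ∧ b) ≡ bit a ℤ.* bit b
bit-∧ false b = refl
bit-∧ true b = sym (ℤ.*-identityˡ (bit b))

restrict : Subset m → (Fin m → ℤ) → Fin m → ℤ
restrict S f e = if does (e ∈? S) then f e else 0ℤ

sumOver-at : (S : Subset m) (w : Fin m → Fin n) (v : Fin n) (f : Fin m → ℤ) →
  sumOver ℤ.+-0-abelianGroup (comprehension (λ e → (e ∈? S) ×-dec (w e ≟ v))) f ≡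
  ℤᶜ.sum (λ e → restrict S f e ℤ.* ℤᶜ.δ v (w e))
sumOver-at S w v f = ℤᶜ.sum-cong-≗ λ e →
  trans (cong (if_then f e else 0ℤ) (does-∈?-tabulate (λ e → does (e ∈? S) ∧ does (w e ≟ v)) e))
    (select (does (e ∈? S)) (does (w e ≟ v)) (f e))
  where
  select : ∀ a b i → (if a ∧ b then i else 0ℤ) ≡ (if a then i else 0ℤ) ℤ.* (if b then 1ℤ else 0ℤ)
  select false b i = refl
  select true false i = sym (ℤ.*-zeroʳ i)
  select true true i = sym (ℤ.*-identityʳ i)

IsCirculation : Graph n m → Orientation m → (Fin m → ℤ) → Set
IsCirculation G D = ℤᶜ.Boundary.IsCycle (tail G D) (head G D)

-- Conservation is only given on `V G`, but no edge ends elsewhere. The restriction to `E G`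
-- replaces the arbitrary values on other labels by 0.
flow⇒circulation : (G : Graph n m) (φ : Flow ℤ.+-0-abelianGroup G) →
  IsCirculation G (Flow.D φ) (restrict (E G) (Flow.f φ))
flow⇒circulation {n} {m} G φ P = trans (∂-expand x P) (ℤᶜ.sum-zero λ v →
  trans (cong (P v ℤ.*_) (balanced v)) (ℤ.*-zeroʳ (P v)))
  where
  open Flow φ
  open ℤᶜ.Boundary (tail G D) (head G D)
  x = restrict (E G) f
  outside : ∀ v → ¬ v ∈ V G → (b : Fin m → Bool) → ∀ e → x e ℤ.* ℤᶜ.δ v (end G e (b e)) ≡ 0ℤ
  outside v v∉V b e with e ∈? E G
  ... | no _ = refl
  ... | yes e∈E = trans (cong (f e ℤ.*_)
    (ℤᶜ.δ-off λ at-v → v∉V (subst (_∈ V G) at-v (end∈V G e∈E (b e))))) (ℤ.*-zeroʳ (f e))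
  balanced : ∀ v → ∂ x (ℤᶜ.δ v) ≡ 0ℤ
  balanced v with v ∈? V G
  ... | yes v∈V = trans (∂-split x (ℤᶜ.δ v)) (ℤ.i≡j⇒i-j≡0
    (trans (sym (sumOver-at (E G) (head G D) v f))
      (trans (sym (conservation v∈V)) (sumOver-at (E G) (tail G D) v f))))
  ... | no v∉V = trans (∂-split x (ℤᶜ.δ v))
    (cong₂ ℤ._-_ (ℤᶜ.sum-zero (outside v v∉V (not ∘ D))) (ℤᶜ.sum-zero (outside v v∉V D)))

circulation⇒flow : (G : Graph n m) (D : Orientation m) (f : Fin m → ℤ) →
  (∀ e → restrict (E G) f e ≡ f e) → IsCirculation G D f → Flow ℤ.+-0-abelianGroup G
circulation⇒flow G D f supp cyc = record
  { D = D
  ; f = f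
  ; conservation = λ {v} _ → trans (sumOver-at (E G) (tail G D) v f)
      (trans (sym (ℤ.i-j≡0⇒i≡j _ _ (trans (sym (∂-split x (ℤᶜ.δ v)))
        (trans (∂-cong supp (ℤᶜ.δ v)) (cyc (ℤᶜ.δ v))))))
        (sym (sumOver-at (E G) (head G D) v f)))
  }
  where
  open ℤᶜ.Boundary (tail G D) (head G D)
  x = restrict (E G) f

-- Reversing an edge and negating its value leaves its boundary unchanged. This passes from the
-- orientation of the given flow to one that directs the circuit.
reorient : (G : Graph n m) (D D′ : Orientation m) (f : Fin m → ℤ) → IsCirculation G D f →
  IsCirculation G D′ (λ e → if D e xor D′ e then ℤ.- f e else f e)
reorient G D D′ f cyc P = trans (ℤᶜ.sum-cong-≗ λ e → turn (D e) (D′ e) (f e) (P ∘ end G e)) (cyc P)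
  where
  turn : ∀ b b′ i (p : Bool → ℤ) →
    (if b xor b′ then ℤ.- i else i) ℤ.* (p (not b′) ℤ.- p b′) ≡ i ℤ.* (p (not b) ℤ.- p b)
  turn false false i p = refl
  turn true true i p = refl
  turn false true i p = lemma i (p true) (p false)
    where
    lemma : ∀ i x y → (ℤ.- i) ℤ.* (y ℤ.- x) ≡ i ℤ.* (x ℤ.- y)
    lemma = solve-∀
  turn true false i p = lemma i (p true) (p false)
    where
    lemma : ∀ i x y → (ℤ.- i) ℤ.* (x ℤ.- y) ≡ i ℤ.* (y ℤ.- x)
    lemma = solve-∀

Lift : Graph n m → Orientation m → (Fin m → ℤ) → (Fin m → Set) → Set
Lift {m = m} G D f P = Σ[ f′ ∈ (Fin m → ℤ) ] IsCirculation G D f′ × (∀ {e} → P e → f′ e ≡ f e)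

-- As functionals on vertex functions P: P differs from P ∘ merge by a multiple
-- of the indicator of the vertex b that is merged into a, so in H the boundary
-- of f is a multiple M of b - a, and it is cancelled by the edge e.
liftContractEdge : (H : Graph n m) (D : Orientation m) (e : Fin m) (f : Fin m → ℤ) →
  IsCirculation (contractEdge H e) D f → Lift H D f (_≢ e)
liftContractEdge {n} {m} H D e f cyc = f′ , f′-cycle , λ {e′} e′≢e →
    trans (cong (λ z → f e′ ℤ.+ K ℤ.* z) (ℤᶜ.δ-off e′≢e))
      (trans (cong (λ a → f e′ ℤ.+ a) (ℤ.*-zeroʳ K)) (ℤ.+-identityʳ (f e′)))
  where
  open ℤᶜ.Boundary (tail H D) (head H D)
  a b : Fin n
  a = end H e true
  b = end H e false
  M K : ℤ
  M = ∂ f (ℤᶜ.δ b)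
  -- When `D e` is true, `e` runs from `a` to `b` and its boundary is b - a, so the coefficient
  -- `- M` cancels M (b - a); otherwise the sign is reversed.
  K = if D e then ℤ.- M else M
  f′ : Fin m → ℤ
  f′ e′ = f e′ ℤ.+ K ℤ.* ℤᶜ.δ e e′
  merge : Fin n → Fin n
  merge w = if does (w ≟ b) then a else w
  module _ (P : Fin n → ℤ) where
    open ≡-Reasoning
    unmerge : ∀ w → P w ≡ P (merge w) ℤ.+ (P b ℤ.- P a) ℤ.* ℤᶜ.δ b w
    unmerge w with w ≟ b
    ... | yes refl = lemma (P w) (P a)
      where
      lemma : ∀ x y → x ≡ y ℤ.+ (x ℤ.- y) ℤ.* 1ℤ
      lemma = solve-∀
    ... | no _ = lemma (P w) (P b ℤ.- P a)
      where
      lemma : ∀ x y → x ≡ x ℤ.+ y ℤ.* 0ℤ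
      lemma = solve-∀
    ∂f : ∂ f P ≡ (P b ℤ.- P a) ℤ.* M
    ∂f = begin
      ∂ f P
        ≡⟨ ℤᶜ.sum-cong-≗ (λ e′ → trans
             (cong₂ (λ x y → f e′ ℤ.* (x ℤ.- y)) (unmerge (head H D e′)) (unmerge (tail H D e′)))
             (distribute (f e′) (P (merge (head H D e′))) (P (merge (tail H D e′)))
               (P b ℤ.- P a) (ℤᶜ.δ b (head H D e′)) (ℤᶜ.δ b (tail H D e′)))) ⟩
      ℤᶜ.sum (λ e′ → f e′ ℤ.* (P (merge (head H D e′)) ℤ.- P (merge (tail H D e′))) ℤ.+
        (P b ℤ.- P a) ℤ.* (f e′ ℤ.* (ℤᶜ.δ b (head H D e′) ℤ.- ℤᶜ.δ b (tail H D e′))))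
        ≡⟨ ℤᶜ.∑-distrib-+ {m} _ _ ⟩
      ℤᶜ.sum (λ e′ → f e′ ℤ.* (P (merge (head H D e′)) ℤ.- P (merge (tail H D e′)))) ℤ.+
        ℤᶜ.sum (λ e′ → (P b ℤ.- P a) ℤ.* (f e′ ℤ.* (ℤᶜ.δ b (head H D e′) ℤ.- ℤᶜ.δ b (tail H D e′))))
        ≡⟨ cong₂ ℤ._+_ (cyc P) (sym (ℤᶜ.*-distribˡ-sum {m} (P b ℤ.- P a) _)) ⟩
      0ℤ ℤ.+ (P b ℤ.- P a) ℤ.* M
        ≡⟨ ℤ.+-identityˡ _ ⟩
      (P b ℤ.- P a) ℤ.* M ∎
      where
      distribute : ∀ i x y z u v →
        i ℤ.* ((x ℤ.+ z ℤ.* u) ℤ.- (y ℤ.+ z ℤ.* v)) ≡ i ℤ.* (x ℤ.- y) ℤ.+ z ℤ.* (i ℤ.* (u ℤ.- v))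
      distribute = solve-∀
    cancel : ∀ d → (P b ℤ.- P a) ℤ.* M ℤ.+
      (if d then ℤ.- M else M) ℤ.* (P (end H e (not d)) ℤ.- P (end H e d)) ≡ 0ℤ
    cancel true = lemma (P b) (P a) M
      where
      lemma : ∀ x y z → (x ℤ.- y) ℤ.* z ℤ.+ (ℤ.- z) ℤ.* (x ℤ.- y) ≡ 0ℤ
      lemma = solve-∀
    cancel false = lemma (P b) (P a) M
      where
      lemma : ∀ x y z → (x ℤ.- y) ℤ.* z ℤ.+ z ℤ.* (y ℤ.- x) ≡ 0ℤ
      lemma = solve-∀
    f′-cycle : ∂ f′ P ≡ 0ℤ
    f′-cycle = begin
      ∂ f′ P                                         ≡⟨ ∂-+ f (λ e′ → K ℤ.* ℤᶜ.δ e e′) P ⟩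
      ∂ f P ℤ.+ ∂ (λ e′ → K ℤ.* ℤᶜ.δ e e′) P         ≡⟨ cong₂ ℤ._+_ ∂f
                                                           (trans (∂-* K (ℤᶜ.δ e) P) (cong (K ℤ.*_) (∂-δ e P))) ⟩
      (P b ℤ.- P a) ℤ.* M ℤ.+ K ℤ.* (P (head H D e) ℤ.- P (tail H D e)) ≡⟨ cancel (D e) ⟩
      0ℤ                                             ∎

contractEdges : Graph n m → List (Fin m) → Graph n m
contractEdges G = foldr (λ e H → contractEdge H e) G

liftContractEdges : (G : Graph n m) (D : Orientation m) (es : List (Fin m)) (f : Fin m → ℤ) →
  IsCirculation (contractEdges G es) D f → Lift G D f (List._∉ es)
liftContractEdges G D [] f cyc = f , cyc , λ _ → refl
liftContractEdges G D (e ∷ es) f cyc = first (liftContractEdge (contractEdges G es) D e f cyc)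
  where
  first : Lift (contractEdges G es) D f (_≢ e) → Lift G D f (List._∉ (e ∷ es))
  first (f′ , cyc′ , same) = let f″ , cyc″ , same′ = liftContractEdges G D es f′ cyc′ in
    f″ , cyc″ , λ e′∉ → trans (same′ (e′∉ ∘ there)) (same (e′∉ ∘ here))

E-contractEdges⁻ : (G : Graph n m) (es : List (Fin m)) {e : Fin m} →
  e ∈ E (contractEdges G es) → e ∈ E G
E-contractEdges⁻ G [] e∈ = e∈
E-contractEdges⁻ G (e ∷ es) e∈ = E-contractEdges⁻ G es (p─q⊆p (E (contractEdges G es)) _ e∈)

E-contractEdges⁺ : (G : Graph n m) (es : List (Fin m)) {e : Fin m} →
  e ∈ E G → e List.∉ es → e ∈ E (contractEdges G es)
E-contractEdges⁺ G [] e∈ _ = e∈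
E-contractEdges⁺ G (e ∷ es) e∈ e∉ =
  x∈p∧x≢y⇒x∈p-y (E-contractEdges⁺ G es e∈ (e∉ ∘ there)) (e∉ ∘ here)

orient-step : (w : Fin m → Bool → Fin n) (o c : Fin m → Bool) {e : Fin m} → c e ≡ true →
  ∀ b → Step (λ e → w e (o e)) (λ e → w e (not (o e))) c (w e b) (w e (not b))
orient-step {m} {n} w o c {e} ce b = orient b (o e) refl
  where
  s t : Fin m → Fin n
  s e = w e (o e)
  t e = w e (not (o e))
  orient : ∀ b d → o e ≡ d → Step s t c (w e b) (w e (not b))
  orient false false oe = subst (λ d → Step s t c (w e d) (w e (not d))) oe (forth ce)
  orient true true oe = subst (λ d → Step s t c (w e d) (w e (not d))) oe (forth ce)
  orient false true oe = subst (λ d → Step s t c (w e (not d)) (w e d)) oe (back ce)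
  orient true false oe = subst (λ d → Step s t c (w e (not d)) (w e d)) oe (back ce)

-- From a circuit of the graph to a directed cycle

module OnCircuit {n m} (G C : Graph n m) (C⊑G : C ⊑ G) (circuit : IsCircuit C) where

  open _⊑_ C⊑G

  c : Fin m → Bool
  c e = does (e ∈? E C)

  inV : Fin n → Bool
  inV v = does (v ∈? V C)

  private
    s₀ t₀ : Fin m → Fin n
    s₀ e = end G e true
    t₀ e = end G e false

  c-end : ∀ e b v → c e ∧ does (end C e b ≟ v) ≡ c e ∧ does (end G e b ≟ v)
  c-end e b v with e ∈? E C
  ... | yes e∈C = cong (λ w → does (w ≟ v)) (end≡ e∈C b)
  ... | no _ = refl

  end∈ : ∀ {e} → c e ≡ true → ∀ b → inV (end G e b) ≡ true
  end∈ ce b = dec-true (_ ∈? V C) (subst (_∈ V C) (end≡ (does⁻ ce) b) (end∈V C (does⁻ ce) b))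

  endCount : Fin n → Bool → ℤ
  endCount v b = count (λ e → c e ∧ does (end G e b ≟ v))

  degree-2 : ∀ {v} → inV v ≡ true → endCount v true ℤ.+ endCount v false ≡ ℤ.+ 2
  degree-2 {v} v∈ = trans (sym (cong₂ ℤ._+_ (ends true) (ends false)))
    (cong ℤ.+_ (proj₂ circuit (does⁻ v∈)))
    where
    ends : ∀ b → ℤ.+ ∣ comprehension (λ e → (e ∈? E C) ×-dec (end C e b ≟ v)) ∣ ≡ endCount v b
    ends b = trans (∣tabulate∣ λ e → c e ∧ does (end C e b ≟ v))
      (ℤᶜ.sum-cong-≗ λ e → cong bit (c-end e b v))

  -- The ℤ₂-boundary at a vertex is the parity of its degree, which is 2 on the circuit; no edge of
  -- `C` meets a vertex outside `V C`.
  circuit-cycle : 𝔹.Boundary.IsCycle s₀ t₀ c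
  circuit-cycle P = trans (∂-expand c P) (𝔹.sum-zero λ v →
    trans (cong (P v ∧_) (even v (inV v) refl)) (Bool.∧-zeroʳ (P v)))
    where
    open 𝔹.Boundary s₀ t₀
    half : ∀ v b → Fin m → Bool
    half v b e = c e ∧ does (end G e b ≟ v)
    δ-does : ∀ (i j : Fin n) → 𝔹.δ i j ≡ does (j ≟ i)
    δ-does i j with does (j ≟ i)
    ... | true = refl
    ... | false = refl
    even : ∀ v b → inV v ≡ b → ∂ c (𝔹.δ v) ≡ false
    even v true v∈ = begin
      ∂ c (𝔹.δ v)
        ≡⟨ ∂-split c (𝔹.δ v) ⟩
      𝔹.sum (λ e → c e ∧ 𝔹.δ v (t₀ e)) xor 𝔹.sum (λ e → c e ∧ 𝔹.δ v (s₀ e))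
        ≡⟨ cong₂ _xor_ (side-parity false) (side-parity true) ⟨
      parity (endCount v false) xor parity (endCount v true)
        ≡⟨ xor-comm (parity (endCount v false)) _ ⟩
      parity (endCount v true) xor parity (endCount v false)
        ≡⟨ parity-+ (endCount v true) (endCount v false) ⟨
      parity (endCount v true ℤ.+ endCount v false)
        ≡⟨ cong parity (degree-2 v∈) ⟩
      false ∎
      where
      open ≡-Reasoning
      side-parity : ∀ b → parity (endCount v b) ≡ 𝔹.sum (λ e → c e ∧ 𝔹.δ v (end G e b))
      side-parity b = trans (parity-sum (bit ∘ half v b)) (𝔹.sum-cong-≗ λ e →
        trans (parity-bit (half v b e)) (cong (c e ∧_) (sym (δ-does v (end G e b)))))
    even v false v∉ = 𝔹.sum-zero λ e → vanish e (c e) refl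
      where
      vanish : ∀ e b → c e ≡ b → c e ∧ (𝔹.δ v (t₀ e) xor 𝔹.δ v (s₀ e)) ≡ false
      vanish e false ce = cong (_∧ (𝔹.δ v (t₀ e) xor 𝔹.δ v (s₀ e))) ce
      vanish e true ce = cong₂ _∧_ ce (cong₂ _xor_ (off false) (off true))
        where
        off : ∀ b → 𝔹.δ v (end G e b) ≡ false
        off b = 𝔹.δ-off {i = v} {end G e b} λ at-v →
          contradiction (trans (sym (end∈ {e} ce b)) (trans (cong inV at-v) v∉)) λ ()

  SparselyExtended : Set
  SparselyExtended = Σ[ φ ∈ KFlow 4 G ]
    ((∀ {e} → e ∈ (E G ─ E C) → KFlow.supp φ e) ×
     4 * ∣ E C ∩ KFlow.zeros φ ∣ < ∣ E C ∣)

  -- By `cyc` in- and out-degrees agree on `C`, and they add up to 2, so both are 1: `o` makes `C` a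
  -- directed cycle. All chains of `G` are then written with respect to `o`, whatever its directions
  -- off `C`.
  module Oriented (o : Fin m → Bool)
    (cyc : ℤᶜ.Boundary.IsCycle s₀ t₀ (λ e → signed (o e) (c e))) where

    s t : Fin m → Fin n
    s = tail G o
    t = head G o

    oriented-cycle : ℤᶜ.Boundary.IsCycle s t (bit ∘ c)
    oriented-cycle P = trans (ℤᶜ.sum-cong-≗ λ e → turn (c e) (o e) (P ∘ end G e)) (cyc P)
      where
      turn : ∀ b d (p : Bool → ℤ) → bit b ℤ.* (p (not d) ℤ.- p d) ≡ signed d b ℤ.* (p false ℤ.- p true)
      turn false d p = refl
      turn true true p = refl
      turn true false p = lemma (p true) (p false)
        where
        lemma : ∀ x y → 1ℤ ℤ.* (x ℤ.- y) ≡ -1ℤ ℤ.* (y ℤ.- x)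
        lemma = solve-∀

    module _ {v : Fin n} (v∈ : inV v ≡ true) where
      outs ins : Fin m → Bool
      outs e = c e ∧ does (s e ≟ v)
      ins e = c e ∧ does (t e ≟ v)

      ins≡outs : count ins ≡ count outs
      ins≡outs = ℤ.i-j≡0⇒i≡j _ _ (trans (cong₂ ℤ._-_ (as-sum t) (as-sum s))
        (trans (sym (∂-split (bit ∘ c) (ℤᶜ.δ v))) (oriented-cycle (ℤᶜ.δ v))))
        where
        open ℤᶜ.Boundary s t
        as-sum : ∀ (w : Fin m → Fin n) →
          count (λ e → c e ∧ does (w e ≟ v)) ≡ ℤᶜ.sum (λ e → bit (c e) ℤ.* ℤᶜ.δ v (w e))
        as-sum w = ℤᶜ.sum-cong-≗ λ e → bit-∧ (c e) (does (w e ≟ v))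

      outs+ins : count outs ℤ.+ count ins ≡ ℤ.+ 2
      outs+ins = trans (sym (ℤᶜ.∑-distrib-+ {m} _ _))
        (trans (ℤᶜ.sum-cong-≗ λ e → swap (o e) λ b → bit (c e ∧ does (end G e b ≟ v)))
        (trans (ℤᶜ.∑-distrib-+ {m} _ _) (degree-2 v∈)))
        where
        swap : ∀ d (p : Bool → ℤ) → p d ℤ.+ p (not d) ≡ p true ℤ.+ p false
        swap true p = refl
        swap false p = ℤ.+-comm (p false) (p true)

      one : (p : Fin m → Bool) → count p ℤ.+ count p ≡ ℤ.+ 2 → ∣ tabulate p ∣ ≡ 1
      one p 2p≡2 = halve ∣ tabulate p ∣ (ℤ.+-injective (trans (cong₂ ℤ._+_ (∣tabulate∣ p) (∣tabulate∣ p)) 2p≡2))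
        where
        halve : ∀ a → a ℕ.+ a ≡ 2 → a ≡ 1
        halve (suc zero) _ = refl
        halve (suc (suc a)) eq =
          contradiction (trans (sym (ℕ.+-suc a (suc a))) (ℕ.suc-injective (ℕ.suc-injective eq))) λ ()

      uniqueAt : (w : Fin m → Fin n) → ∣ tabulate (λ e → c e ∧ does (w e ≟ v)) ∣ ≡ 1 → UniqueAt c w v
      uniqueAt w single with singleton (λ e → c e ∧ does (w e ≟ v)) single
      ... | e , e-in , only = record
        { edge = e
        ; edge∈c = Bool.∧-conicalˡ _ _ e-in
        ; edge-at = at (w e ≟ v) (Bool.∧-conicalʳ (c e) _ e-in)
        ; unique = λ {e′} ce′ at-v → only e′ (cong₂ _∧_ ce′ (dec-true (w e′ ≟ v) at-v))
        }
        where
        at : ∀ {u} (d : Dec (u ≡ v)) → does d ≡ true → u ≡ v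
        at (yes u≡v) _ = u≡v

      outE : UniqueAt c s v
      outE = uniqueAt s (one outs (trans (cong (λ z → count outs ℤ.+ z) (sym ins≡outs)) outs+ins))

      inE : UniqueAt c t v
      inE = uniqueAt t (one ins (trans (cong (λ z → z ℤ.+ count ins) ins≡outs) outs+ins))

    connected : ∀ {u v} → inV u ≡ true → inV v ≡ true → Star (Step s t c) u v
    connected u∈ v∈ = walk (proj₂ (proj₁ circuit) (does⁻ u∈) (does⁻ v∈))
      where
      walk : ∀ {u v} → Star (Adjacent C) u v → Star (Step s t c) u v
      walk ε = ε
      walk ((e , b , e∈C , refl , refl) ◅ p) =
        subst₂ (Step s t c) (sym (end≡ e∈C b)) (sym (end≡ e∈C (not b)))
          (orient-step (end G) o c (dec-true (e ∈? E C) e∈C) b)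
        ◅ walk p

    root : Fin n
    root = proj₁ (proj₁ (proj₁ circuit))

    r∈V : inV root ≡ true
    r∈V = dec-true (_ ∈? V C) (proj₂ (proj₁ (proj₁ circuit)))

    open Circuit s t c inV (λ {e} ce → end∈ ce (o e)) (λ {e} ce → end∈ ce (not (o e)))
      outE inE connected {root} r∈V public using (SparseFlow; sparseFlow)

    u : Fin m → Bool
    u e = does (e ∈? E G)

    -- Contraction removes from `E G` exactly the edges of `C`. Off `C` the lift therefore is the
    -- given flow on edges of `G` and 0 on all other labels.
    sparse : (φ : KFlow 4 (G / C)) → KFlow.NowhereZero φ → SparseFlow u
    sparse φ nowhereZero = apply (liftContractEdges G D (elements (E C)) f̂ (flow⇒circulation (G / C) flow))
      where
      open KFlow φ
      f̂ = restrict (E (G / C)) f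
      off-elements : ∀ {e} → c e ≡ false → e List.∉ elements (E C)
      off-elements ce e∈ = contradiction (trans (sym (dec-true (_ ∈? E C)
        (proj₂ (∈-filter⁻ (_∈? E C) {xs = allFin m} e∈)))) ce) λ ()
      apply : Lift G D f̂ (List._∉ elements (E C)) → SparseFlow u
      apply (f′ , cyc′ , same) = sparseFlow {f = f″} (reorient G D o f′ cyc′)
        (λ ce ue → f″-zero (trans (same (off-elements ce)) (outside (deleted ue))))
        λ ce ue → nonzero (trans (same (off-elements ce)) (inside (kept ce ue))) (kept ce ue)
        where
        f″ : Fin m → ℤ
        f″ e = if D e xor o e then ℤ.- f′ e else f′ e
        outside : ∀ {e} → ¬ e ∈ E (G / C) → f̂ e ≡ 0ℤ
        outside {e} e∉ = cong (if_then f e else 0ℤ) (dec-false (e ∈? E (G / C)) e∉)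
        inside : ∀ {e} → e ∈ E (G / C) → f̂ e ≡ f e
        inside {e} e∈ = cong (if_then f e else 0ℤ) (dec-true (e ∈? E (G / C)) e∈)
        deleted : ∀ {e} → u e ≡ false → ¬ e ∈ E (G / C)
        deleted ue e∈ = contradiction (trans (sym (dec-true (_ ∈? E G)
          (E-contractEdges⁻ G (elements (E C)) e∈))) ue) λ ()
        kept : ∀ {e} → c e ≡ false → u e ≡ true → e ∈ E (G / C)
        kept ce ue = E-contractEdges⁺ G (elements (E C)) (does⁻ ue) (off-elements ce)
        f″-zero : ∀ {e} → f′ e ≡ 0ℤ → f″ e ≡ 0ℤ
        f″-zero {e} f′e≡0 with D e xor o e
        ... | true = cong ℤ.-_ f′e≡0
        ... | false = f′e≡0
        nonzero : ∀ {e} → f′ e ≡ f e → e ∈ E (G / C) → f″ e ≢ 0ℤ × ℤ.∣ f″ e ∣ < 4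
        nonzero {e} f′e≡fe e∈ with D e xor o e
        ... | false = (λ f′e≡0 → proj₂ (nowhereZero e∈) (trans (sym f′e≡fe) f′e≡0)) ,
          subst (λ i → ℤ.∣ i ∣ < 4) (sym f′e≡fe) (bounded e∈)
        ... | true = (λ -f′e≡0 → proj₂ (nowhereZero e∈) (trans (sym f′e≡fe) (ℤ.neg-injective -f′e≡0))) ,
          subst (_< 4) (trans (cong ℤ.∣_∣ (sym f′e≡fe)) (sym (ℤ.∣-i∣≡∣i∣ (f′ e)))) (bounded e∈)

    conclude : SparseFlow u → SparselyExtended
    conclude (f , f-cycle , f<4 , f-off , sparse) = φ , on-rest , fewZeros
      where
      -- A label outside `E G` is outside `E C` too, so `f-off` applies and makes `f` vanish there.
      supported : ∀ e → restrict (E G) f e ≡ f e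
      supported e with e ∈? E G in eq
      ... | yes _ = refl
      ... | no e∉G = sym (zero⁻ (trans (f-off (dec-false (e ∈? E C) (e∉G ∘ E⊆))) (cong (not ∘ does) eq)))
        where
        zero⁻ : ∀ {i} → does (i ℤ.≟ 0ℤ) ≡ true → i ≡ 0ℤ
        zero⁻ {i} d with i ℤ.≟ 0ℤ
        ... | yes i≡0 = i≡0
      φ : KFlow 4 G
      φ = record { flow = circulation⇒flow G o f supported f-cycle ; bounded = λ {e} _ → f<4 e }
      on-rest : ∀ {e} → e ∈ (E G ─ E C) → KFlow.supp φ e
      on-rest {e} e∈ = e∈G , λ fe≡0 → contradiction
        (trans (sym (dec-true (f e ℤ.≟ 0ℤ) fe≡0))
          (trans (f-off (dec-false (e ∈? E C) e∉C)) (cong not (dec-true (e ∈? E G) e∈G)))) λ ()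
        where
        e∈G : e ∈ E G
        e∈G = p─q⊆p (E G) (E C) e∈
        e∉C : ¬ e ∈ E C
        e∉C = x∈p─q⇒x∉q (E G) (E C) e∈
      zeros⊆ : (E C ∩ KFlow.zeros φ) ⊆ tabulate (λ e → c e ∧ does (f e ℤ.≟ 0ℤ))
      zeros⊆ {e} e∈ = let e∈C , e∈Z = x∈p∩q⁻ (E C) (KFlow.zeros φ) e∈ in
        ∈-tabulate⁺ _ (cong₂ _∧_ (dec-true (e ∈? E C) e∈C)
          (Bool.∧-conicalʳ (does (e ∈? E G)) _ (∈-tabulate⁻ (λ e → does (e ∈? E G) ∧ does (f e ℤ.≟ 0ℤ)) e∈Z)))
      fewZeros : 4 * ∣ E C ∩ KFlow.zeros φ ∣ < ∣ E C ∣
      fewZeros = ℕ.≤-<-trans (ℕ.*-monoʳ-≤ 4 (p⊆q⇒∣p∣≤∣q∣ zeros⊆))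
        (ℕ.<-≤-trans sparse (p⊆q⇒∣p∣≤∣q∣ λ e∈ → does⁻ (∈-tabulate⁻ c e∈)))

  sparselyExtended : (Σ[ φ ∈ KFlow 4 (G / C) ] KFlow.NowhereZero φ) → SparselyExtended
  sparselyExtended (φ , nowhereZero) = orient (signed-even s₀ t₀ c circuit-cycle)
    where
    orient : Orients s₀ t₀ c → SparselyExtended
    orient (o , cyc) = let open Oriented o cyc in conclude (sparse φ nowhereZero)

corollary2p2 : ∀ {n m : ℕ} (G C : Graph n m) → C ⊑ G → IsCircuit C →
    (Σ[ φ ∈ KFlow 4 (G / C) ] KFlow.NowhereZero φ) →
    Σ[ φ ∈ KFlow 4 G ]
    ((∀ {e} → e ∈ (E G ─ E C) → KFlow.supp φ e) ×
    4 * ∣ E C ∩ KFlow.zeros φ ∣ < ∣ E C ∣)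
corollary2p2 G C C⊑G circuit = OnCircuit.sparselyExtended G C C⊑G circuit
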